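{- Let $n>0$ be an integer and $a\in\{0,1\}$. Then \[ \sum_{0\le 3j\le n-a}\frac{(q^3;q^3)_{n-j-1}(1-q^{2n+a})\,q^{3j^2+3j}}{(q;q)_{n-3j-a}\,(q^6;q^6)_{j}} \;=\; \sum_{j=-\infty}^{\infty}(-1)^j q^{6j^2+3j}{2n+a\brack n-3j-a}_q . \]
   Context: For a non-negative integer $L$, $(a;q)_L=\prod_{k=0}^{L-1}(1-aq^k)$. For integers $m,n$, the $q$-binomial coefficient is ${m+n\brack n}_q=\frac{(q;q)_{m+n}}{(q;q)_m(q;q)_n}$ if $m,n\ge 0$ and $0$ otherwise. -}

module Defs where

-- Formal power series in q with integer coefficients: f k = coefficient of q^k.
-- All identities below are identities in ℤ[[q]] (equality coefficientwise).

open import Data.Nat as ℕ using (ℕ; zero; suc)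
open import Data.Nat.Divisibility using (_∣?_)
open import Data.Integer as ℤ using (ℤ; +_)
open import Relation.Nullary.Decidable using (does)
open import Data.Bool using (if_then_else_)

PS : Set
PS = ℕ → ℤ

0ₚ : PS
0ₚ _ = + 0

1ₚ : PS
1ₚ zero    = + 1
1ₚ (suc _) = + 0

qpow : ℕ → PS
qpow e k = if does (e ℕ.≟ k) then + 1 else + 0

infixl 6 _+ₚ_ _-ₚ_
infixl 7 _*ₚ_ _·ₚ_

_+ₚ_ : PS → PS → PS
(f +ₚ g) k = f k ℤ.+ g k

_-ₚ_ : PS → PS → PS
(f -ₚ g) k = f k ℤ.- g k

_·ₚ_ : ℤ → PS → PS
(c ·ₚ f) k = c ℤ.* f k

sumℤ : (ℕ → ℤ) → ℕ → ℤ
sumℤ h zero    = + 0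
sumℤ h (suc m) = sumℤ h m ℤ.+ h m

_*ₚ_ : PS → PS → PS
(f *ₚ g) k = sumℤ (λ i → f i ℤ.* g (k ℕ.∸ i)) (suc k)

sumPS : (ℕ → PS) → ℕ → PS
sumPS F zero    = 0ₚ
sumPS F (suc m) = sumPS F m +ₚ F m

prodPS : (ℕ → PS) → ℕ → PS
prodPS F zero    = 1ₚ
prodPS F (suc m) = prodPS F m *ₚ F m

sumℤrange : (ℤ → PS) → ℕ → PS
sumℤrange F N = sumPS (λ i → F (+ i ℤ.- + N)) (suc (N ℕ.+ N))

-- 1/(1 - q^m) = Σ_{t ≥ 0} q^{m t}, used only for m ≥ 1
geomInv : ℕ → PS
geomInv m k = if does (m ∣? k) then + 1 else + 0

poch : ℕ → ℕ → PS
poch s L = prodPS (λ i → 1ₚ -ₚ qpow (s ℕ.* suc i)) L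

pochInv : ℕ → ℕ → PS
pochInv s L = prodPS (λ i → geomInv (s ℕ.* suc i)) L

-- q-binomial [m+n brack n]_q for integers m, n; zero unless m, n ≥ 0
qbin : ℤ → ℤ → PS
qbin (+ m) (+ n) = poch 1 (m ℕ.+ n) *ₚ pochInv 1 m *ₚ pochInv 1 n
qbin _     _     = 0ₚ

{-# OPTIONS --safe #-}

-- Put Q = q³.  A cubic case of the q-Pfaff–Saalschütz sum gives, for j ≥ 0,
--   q^{3j²+3aj} [2n+a brack n-3j-a]_q = (1 - q^{2n+a}) Σ_r γ_r / ((Q;Q)_{r-j} (Q;Q)_{r+j+a})
-- with γ_r = q^{3r²+3ar} (Q;Q)_{n-r-1} / (q;q)_{n-3r-a} independent of j.  After pairing j with
-- -1-j on the right-hand side of the theorem and exchanging the two sums, the inner sum over j is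
-- evaluated by Σ_{j≥0} (-1)^j Q^{j²} (1 - Q^{2j+1}) / ((Q;Q)_{r-j} (Q;Q)_{r+j+1}) = 1 / (Q²;Q²)_r.
-- Both summations are proved by Wilf–Zeilberger recurrences, in any commutative ring with elements
-- q^k for which 1 - q^k is invertible when k > 0.
module Submission where

-- The reflection j ↦ -1-j acts differently for the two values of a. For a = 1 it fixes the
-- q-binomial and multiplies the power of q by Q^{2j+1}, so each pair carries the factor 1 -
-- Q^{2j+1} at once. For a = 0 it moves the q-binomial from j to j+1; there the difference of
-- neighbouring terms 1 / ((Q;Q)_{r-j} (Q;Q)_{r+j}) supplies the same factor, with a surplus power
-- of Q. That surplus turns q^{3r²} into q^{3r²+3r}, which is why the left-hand side has one
-- exponent for both a. Reciprocals 1 / (q;q)_{r-j} count as 0 for j > r. All sums can then run to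
-- one common bound, so that they are exchanged over a square and the certificates vanish at the
-- upper end. The price lies at the boundary: each recurrence is checked separately outside the
-- support, at its edge and inside it. Inside, writing the larger index as the smaller one plus e
-- removes the subtractions and leaves a polynomial identity for the ring solver.

open import Algebra.Bundles using (CommutativeRing)
open import Algebra.Structures using (IsCommutativeRing)
import Algebra.Solver.Ring
import Algebra.Solver.Ring.AlmostCommutativeRing as ACR
open import Data.Bool using (true; false; if_then_else_)
open import Data.Integer as ℤ using (ℤ; +_; -[1+_]; ∣_∣)
import Data.Integer.Properties as ℤₚ
import Data.Integer.Tactic.RingSolver as ℤRing
open import Data.Maybe.Base using (Maybe; just; nothing)
open import Data.Nat as ℕ using (ℕ; zero; suc; _∸_; _≤_; _<_; _≤ᵇ_; z≤n; s≤s; z<s)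
open import Data.Nat.Divisibility using (_∣?_; ∣m+n∣m⇒∣n; ∣m∣n⇒∣m+n; ∣-refl; ∣⇒≤; _∣0)
import Data.Nat.Properties as ℕₚ
import Data.Nat.Tactic.RingSolver as ℕRing
open import Data.Product using (_,_)
open import Function using (mk⇔)
open import Level using (0ℓ)
open import Relation.Binary.Definitions using (tri<; tri≈; tri>)
open import Relation.Binary.PropositionalEquality as ≡ using (_≡_; _≢_; _≗_; module ≡-Reasoning)
open import Relation.Nullary using (yes; no)
open import Relation.Nullary.Decidable using (dec-true; dec-false; does-⇔)
open import Relation.Nullary.Reflects using (ofʸ; ofⁿ)

-- Equality in an abstract ring is undecidable, so the ring solver cancels terms only if its coefficients lie in ℤ.
module IntegerCoefficientSolver {c ℓ} (R : CommutativeRing c ℓ) where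
  open CommutativeRing R
  open import Algebra.Properties.Ring ring using (-0#≈0#; -‿involutive; -‿distribˡ-*; -‿distribʳ-*)
  open import Algebra.Properties.AbelianGroup +-abelianGroup using (⁻¹-∙-comm)
  open import Algebra.Properties.CommutativeSemigroup +-commutativeSemigroup using (interchange)
  open import Relation.Binary.Reasoning.Setoid setoid

  -- The clause for 1 makes the image of + 1 definitionally 1#.
  fromℕ : ℕ → Carrier
  fromℕ 0             = 0#
  fromℕ 1             = 1#
  fromℕ (suc (suc n)) = 1# + fromℕ (suc n)

  fromℕ-suc : ∀ n → fromℕ (suc n) ≈ 1# + fromℕ n
  fromℕ-suc zero    = sym (+-identityʳ 1#)
  fromℕ-suc (suc n) = refl

  fromℕ-+ : ∀ m n → fromℕ (m ℕ.+ n) ≈ fromℕ m + fromℕ n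
  fromℕ-+ zero    n = sym (+-identityˡ _)
  fromℕ-+ (suc m) n = begin
    fromℕ (suc (m ℕ.+ n))     ≈⟨ fromℕ-suc (m ℕ.+ n) ⟩
    1# + fromℕ (m ℕ.+ n)      ≈⟨ +-congˡ (fromℕ-+ m n) ⟩
    1# + (fromℕ m + fromℕ n)  ≈⟨ +-assoc _ _ _ ⟨
    (1# + fromℕ m) + fromℕ n  ≈⟨ +-congʳ (fromℕ-suc m) ⟨
    fromℕ (suc m) + fromℕ n   ∎

  fromℕ-* : ∀ m n → fromℕ (m ℕ.* n) ≈ fromℕ m * fromℕ n
  fromℕ-* zero    n = sym (zeroˡ _)
  fromℕ-* (suc m) n = begin
    fromℕ (n ℕ.+ m ℕ.* n)               ≈⟨ fromℕ-+ n (m ℕ.* n) ⟩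
    fromℕ n + fromℕ (m ℕ.* n)           ≈⟨ +-cong (sym (*-identityˡ _)) (fromℕ-* m n) ⟩
    1# * fromℕ n + fromℕ m * fromℕ n    ≈⟨ distribʳ _ _ _ ⟨
    (1# + fromℕ m) * fromℕ n            ≈⟨ *-congʳ (fromℕ-suc m) ⟨
    fromℕ (suc m) * fromℕ n             ∎

  fromℤ : ℤ → Carrier
  fromℤ (+ n)    = fromℕ n
  fromℤ -[1+ n ] = - fromℕ (suc n)

  fromℤ-⊖ : ∀ m n → fromℤ (m ℤ.⊖ n) ≈ fromℕ m - fromℕ n
  fromℤ-⊖ m zero = begin
    fromℕ m          ≈⟨ +-identityʳ _ ⟨
    fromℕ m + 0#     ≈⟨ +-congˡ -0#≈0# ⟨
    fromℕ m - 0#     ∎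
  fromℤ-⊖ zero    (suc n) = sym (+-identityˡ _)
  fromℤ-⊖ (suc m) (suc n) = begin
    fromℤ (suc m ℤ.⊖ suc n)                 ≈⟨ reflexive (≡.cong fromℤ (ℤₚ.[1+m]⊖[1+n]≡m⊖n m n)) ⟩
    fromℤ (m ℤ.⊖ n)                         ≈⟨ fromℤ-⊖ m n ⟩
    fromℕ m - fromℕ n                       ≈⟨ +-identityˡ _ ⟨
    0# + (fromℕ m - fromℕ n)                ≈⟨ +-congʳ (-‿inverseʳ 1#) ⟨
    (1# - 1#) + (fromℕ m - fromℕ n)         ≈⟨ interchange _ _ _ _ ⟩
    (1# + fromℕ m) + (- 1# - fromℕ n)       ≈⟨ +-congˡ (⁻¹-∙-comm 1# (fromℕ n)) ⟩
    (1# + fromℕ m) - (1# + fromℕ n)         ≈⟨ +-cong (fromℕ-suc m) (-‿cong (fromℕ-suc n)) ⟨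
    fromℕ (suc m) - fromℕ (suc n)           ∎

  fromℤ-neg : ∀ i → fromℤ (ℤ.- i) ≈ - fromℤ i
  fromℤ-neg (+ zero)  = sym -0#≈0#
  fromℤ-neg (+ suc n) = refl
  fromℤ-neg -[1+ n ]  = sym (-‿involutive _)

  fromℤ-+ : ∀ i j → fromℤ (i ℤ.+ j) ≈ fromℤ i + fromℤ j
  fromℤ-+ (+ m)    (+ n)    = fromℕ-+ m n
  fromℤ-+ (+ m)    -[1+ n ] = fromℤ-⊖ m (suc n)
  fromℤ-+ -[1+ m ] (+ n)    = trans (fromℤ-⊖ n (suc m)) (+-comm _ _)
  fromℤ-+ -[1+ m ] -[1+ n ] = begin
    - fromℕ (suc (suc (m ℕ.+ n)))           ≈⟨ -‿cong (reflexive (≡.cong (λ k → fromℕ (suc k)) (≡.sym (ℕₚ.+-suc m n)))) ⟩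
    - fromℕ (suc m ℕ.+ suc n)               ≈⟨ -‿cong (fromℕ-+ (suc m) (suc n)) ⟩
    - (fromℕ (suc m) + fromℕ (suc n))       ≈⟨ ⁻¹-∙-comm _ _ ⟨
    - fromℕ (suc m) - fromℕ (suc n)         ∎

  fromℤ-+*+ : ∀ m n → fromℤ ((+ m) ℤ.* (+ n)) ≈ fromℕ m * fromℕ n
  fromℤ-+*+ m n = trans (reflexive (≡.cong fromℤ (≡.sym (ℤₚ.pos-* m n)))) (fromℕ-* m n)

  fromℤ-* : ∀ i j → fromℤ (i ℤ.* j) ≈ fromℤ i * fromℤ j
  fromℤ-* (+ m)    (+ n)    = fromℤ-+*+ m n
  fromℤ-* (+ m)    -[1+ n ] = begin
    fromℤ (+ m ℤ.* ℤ.- (+ suc n))    ≈⟨ reflexive (≡.cong fromℤ (≡.sym (ℤₚ.neg-distribʳ-* (+ m) (+ suc n)))) ⟩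
    fromℤ (ℤ.- (+ m ℤ.* + suc n))    ≈⟨ fromℤ-neg (+ m ℤ.* + suc n) ⟩
    - fromℤ (+ m ℤ.* + suc n)        ≈⟨ -‿cong (fromℤ-+*+ m (suc n)) ⟩
    - (fromℕ m * fromℕ (suc n))      ≈⟨ -‿distribʳ-* _ _ ⟩
    fromℕ m * - fromℕ (suc n)        ∎
  fromℤ-* -[1+ m ] (+ n)    = begin
    fromℤ (ℤ.- (+ suc m) ℤ.* + n)    ≈⟨ reflexive (≡.cong fromℤ (≡.sym (ℤₚ.neg-distribˡ-* (+ suc m) (+ n)))) ⟩
    fromℤ (ℤ.- (+ suc m ℤ.* + n))    ≈⟨ fromℤ-neg (+ suc m ℤ.* + n) ⟩
    - fromℤ (+ suc m ℤ.* + n)        ≈⟨ -‿cong (fromℤ-+*+ (suc m) n) ⟩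
    - (fromℕ (suc m) * fromℕ n)      ≈⟨ -‿distribˡ-* _ _ ⟩
    - fromℕ (suc m) * fromℕ n        ∎
  fromℤ-* -[1+ m ] -[1+ n ] = begin
    fromℤ (+ suc m ℤ.* + suc n)          ≈⟨ fromℤ-+*+ (suc m) (suc n) ⟩
    fromℕ (suc m) * fromℕ (suc n)        ≈⟨ -‿involutive _ ⟨
    - - (fromℕ (suc m) * fromℕ (suc n))  ≈⟨ -‿cong (-‿distribˡ-* _ _) ⟩
    - (- fromℕ (suc m) * fromℕ (suc n))  ≈⟨ -‿distribʳ-* _ _ ⟩
    - fromℕ (suc m) * - fromℕ (suc n)    ∎

  homomorphism : ℤ.+-*-rawRing ACR.-Raw-AlmostCommutative⟶ ACR.fromCommutativeRing R
  homomorphism = record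
    { ⟦_⟧    = fromℤ
    ; +-homo = fromℤ-+
    ; *-homo = fromℤ-*
    ; -‿homo = fromℤ-neg
    ; 0-homo = refl
    ; 1-homo = refl
    }

  -- Distinct integers may have equal images, for instance in positive characteristic. The solver
  -- only needs a sound test, so `nothing` is a legitimate answer there.
  fromℤ≟ : ∀ i j → Maybe (fromℤ i ≈ fromℤ j)
  fromℤ≟ i j with i ℤ.≟ j
  ... | yes i≡j = just (reflexive (≡.cong fromℤ i≡j))
  ... | no _    = nothing

  open Algebra.Solver.Ring ℤ.+-*-rawRing (ACR.fromCommutativeRing R) homomorphism fromℤ≟ public
    using (Polynomial; solve; con; _:=_; _:+_; _:*_; _:-_; :-_)

  𝟘 𝟙 : ∀ {n} → Polynomial n
  𝟘 = con (+ 0)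
  𝟙 = con (+ 1)

-- Finite sums, telescoping, and folding of two-sided sums.

module FiniteSums {c ℓ} (R : CommutativeRing c ℓ) where
  open CommutativeRing R
  open import Algebra.Properties.CommutativeSemigroup +-commutativeSemigroup using (interchange)
  open import Relation.Binary.Reasoning.Setoid setoid

  sum : (ℕ → Carrier) → ℕ → Carrier
  sum f zero    = 0#
  sum f (suc n) = sum f n + f n

  sum-cong : ∀ {f g} n → (∀ i → i < n → f i ≈ g i) → sum f n ≈ sum g n
  sum-cong zero    f≈g = refl
  sum-cong (suc n) f≈g =
    +-cong (sum-cong n λ i i<n → f≈g i (ℕₚ.m<n⇒m<1+n i<n)) (f≈g n (ℕₚ.n<1+n n))

  sum-0 : ∀ {f} n → (∀ i → i < n → f i ≈ 0#) → sum f n ≈ 0#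
  sum-0 zero    f≈0 = refl
  sum-0 (suc n) f≈0 = trans
    (+-cong (sum-0 n λ i i<n → f≈0 i (ℕₚ.m<n⇒m<1+n i<n)) (f≈0 n (ℕₚ.n<1+n n)))
    (+-identityʳ 0#)

  sum-+ : ∀ f g n → sum (λ i → f i + g i) n ≈ sum f n + sum g n
  sum-+ f g zero    = sym (+-identityʳ 0#)
  sum-+ f g (suc n) = trans (+-congʳ (sum-+ f g n)) (interchange _ _ _ _)

  sum-*ˡ : ∀ x f n → sum (λ i → x * f i) n ≈ x * sum f n
  sum-*ˡ x f zero    = sym (zeroʳ x)
  sum-*ˡ x f (suc n) = trans (+-congʳ (sum-*ˡ x f n)) (sym (distribˡ _ _ _))

  sum-swap : ∀ (f : ℕ → ℕ → Carrier) m n →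
    sum (λ i → sum (f i) n) m ≈ sum (λ j → sum (λ i → f i j) m) n
  sum-swap f zero    n = sym (sum-0 n λ _ _ → refl)
  sum-swap f (suc m) n = trans (+-congʳ (sum-swap f m n)) (sym (sum-+ _ _ n))

  sum-split : ∀ f m n → sum f (m ℕ.+ n) ≈ sum f m + sum (λ i → f (m ℕ.+ i)) n
  sum-split f m zero    = trans (reflexive (≡.cong (sum f) (ℕₚ.+-identityʳ m))) (sym (+-identityʳ _))
  sum-split f m (suc n) = begin
    sum f (m ℕ.+ suc n)                                           ≈⟨ reflexive (≡.cong (sum f) (ℕₚ.+-suc m n)) ⟩
    sum f (m ℕ.+ n) + f (m ℕ.+ n)                                 ≈⟨ +-congʳ (sum-split f m n) ⟩
    (sum f m + sum (λ i → f (m ℕ.+ i)) n) + f (m ℕ.+ n)           ≈⟨ +-assoc _ _ _ ⟩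
    sum f m + (sum (λ i → f (m ℕ.+ i)) n + f (m ℕ.+ n))           ∎

  sum-head : ∀ f n → (∀ i → f (suc i) ≈ 0#) → sum f (suc n) ≈ f 0
  sum-head f n f≈0 = begin
    sum f (suc n)                            ≈⟨ sum-split f 1 n ⟩
    (0# + f 0) + sum (λ i → f (suc i)) n     ≈⟨ +-cong (+-identityˡ _) (sum-0 n λ i _ → f≈0 i) ⟩
    f 0 + 0#                                 ≈⟨ +-identityʳ _ ⟩
    f 0                                      ∎

  -- This is the summation half of the Wilf-Zeilberger method: `f` and `f′` are the multiples of the
  -- new and the old summand in the recurrence, and `g` is the certificate. Placing `g` on both
  -- sides keeps `step` free of subtraction.
  sum-telescope : ∀ {f f′} (g : ℕ → Carrier) n →
    (∀ i → f i + g (suc i) ≈ f′ i + g i) → g 0 ≈ 0# → g n ≈ 0# → sum f n ≈ sum f′ n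
  sum-telescope {f} {f′} g n step g0≈0 gn≈0 = begin
    sum f n            ≈⟨ +-identityʳ _ ⟨
    sum f n + 0#       ≈⟨ +-congˡ gn≈0 ⟨
    sum f n + g n      ≈⟨ go n ⟩
    sum f′ n + g 0     ≈⟨ +-congˡ g0≈0 ⟩
    sum f′ n + 0#      ≈⟨ +-identityʳ _ ⟩
    sum f′ n           ∎
    where
    go : ∀ k → sum f k + g k ≈ sum f′ k + g 0
    go zero    = refl
    go (suc k) = begin
      (sum f k + f k) + g (suc k)    ≈⟨ +-assoc _ _ _ ⟩
      sum f k + (f k + g (suc k))    ≈⟨ +-congˡ (trans (step k) (+-comm _ _)) ⟩
      sum f k + (g k + f′ k)         ≈⟨ +-assoc _ _ _ ⟨
      (sum f k + g k) + f′ k         ≈⟨ +-congʳ (go k) ⟩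
      (sum f′ k + g 0) + f′ k        ≈⟨ +-assoc _ _ _ ⟩
      sum f′ k + (g 0 + f′ k)        ≈⟨ +-congˡ (+-comm _ _) ⟩
      sum f′ k + (f′ k + g 0)        ≈⟨ +-assoc _ _ _ ⟨
      (sum f′ k + f′ k) + g 0        ∎

  sumℤrange : (ℤ → Carrier) → ℕ → Carrier
  sumℤrange F N = sum (λ i → F (+ i ℤ.- + N)) (suc (N ℕ.+ N))

  sum-shifted : ∀ (F : ℤ → Carrier) M L →
    sum (λ i → F (+ i ℤ.- + M)) (M ℕ.+ L) ≈ sum (λ j → F -[1+ j ]) M + sum (λ j → F (+ j)) L
  sum-shifted F zero    L = trans
    (sum-cong L λ i _ → reflexive (≡.cong F (ℤₚ.+-identityʳ (+ i))))
    (sym (+-identityˡ _))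
  sum-shifted F (suc M) L = begin
    sum (λ i → F (+ i ℤ.- + suc M)) (suc M ℕ.+ L)
      ≈⟨ sum-split _ 1 (M ℕ.+ L) ⟩
    (0# + F -[1+ M ]) + sum (λ i → F (+ suc i ℤ.- + suc M)) (M ℕ.+ L)
      ≈⟨ +-cong (+-identityˡ _) (sum-cong (M ℕ.+ L) λ i _ → reflexive (≡.cong F (shift i))) ⟩
    F -[1+ M ] + sum (λ i → F (+ i ℤ.- + M)) (M ℕ.+ L)
      ≈⟨ +-congˡ (sum-shifted F M L) ⟩
    F -[1+ M ] + (sum (λ j → F -[1+ j ]) M + sum (λ j → F (+ j)) L)
      ≈⟨ trans (sym (+-assoc _ _ _)) (+-congʳ (+-comm _ _)) ⟩
    sum (λ j → F -[1+ j ]) (suc M) + sum (λ j → F (+ j)) L  ∎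
    where
    shift : ∀ i → + suc i ℤ.- + suc M ≡ + i ℤ.- + M
    shift i = ≡.trans (ℤₚ.[1+m]⊖[1+n]≡m⊖n i M) (≡.sym (ℤₚ.m-n≡m⊖n i M))

  -- The window from -N to N is not closed under j ↦ -1-j: the index N lacks its partner -1-N. Since
  -- `F` is zero at that partner, it can be adjoined to complete the pairing.
  sumℤrange-fold : ∀ F N → F -[1+ N ] ≈ 0# →
    sumℤrange F N ≈ sum (λ j → F (+ j) + F -[1+ j ]) (suc N)
  sumℤrange-fold F N F≈0 = begin
    sumℤrange F N
      ≈⟨ reflexive (≡.cong (sum _) (≡.sym (ℕₚ.+-suc N N))) ⟩
    sum (λ i → F (+ i ℤ.- + N)) (N ℕ.+ suc N)
      ≈⟨ sum-shifted F N (suc N) ⟩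
    sum (λ j → F -[1+ j ]) N + sum (λ j → F (+ j)) (suc N)
      ≈⟨ +-congʳ (trans (+-congˡ F≈0) (+-identityʳ _)) ⟨
    sum (λ j → F -[1+ j ]) (suc N) + sum (λ j → F (+ j)) (suc N)
      ≈⟨ +-comm _ _ ⟩
    sum (λ j → F (+ j)) (suc N) + sum (λ j → F -[1+ j ]) (suc N)
      ≈⟨ sum-+ _ _ (suc N) ⟨
    sum (λ j → F (+ j) + F -[1+ j ]) (suc N)  ∎

-- q-Pochhammer symbols and their reciprocals in an abstract ring.

module QSeries {c ℓ} (R : CommutativeRing c ℓ) where
  open CommutativeRing R
  open FiniteSums R public
  open IntegerCoefficientSolver R using (solve; 𝟘; 𝟙; _:=_; _:+_; _:*_; _:-_; :-_)
  open import Relation.Binary.Reasoning.Setoid setoid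

  module Pochhammer
    (q^_ : ℕ → Carrier)
    (q^-0 : q^ 0 ≈ 1#)
    (q^-+ : ∀ m n → q^ (m ℕ.+ n) ≈ q^ m * q^ n)
    (ι : ℕ → Carrier)
    (ι-inverse : ∀ k → (1# - q^ suc k) * ι (suc k) ≈ 1#)
    where

    q^-≡ : ∀ {m n} → m ≡ n → q^ m ≈ q^ n
    q^-≡ m≡n = reflexive (≡.cong q^_ m≡n)

    1-‿cong : ∀ {x y} → x ≈ y → 1# - x ≈ 1# - y
    1-‿cong eq = +-congˡ (-‿cong eq)

    1-q^0 : 1# - q^ 0 ≈ 0#
    1-q^0 = trans (1-‿cong q^-0) (-‿inverseʳ 1#)

    q^-suc : ∀ n → q^ suc n ≈ q^ 1 * q^ n
    q^-suc n = q^-+ 1 n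

    -- The ring need not be a domain; cancellation comes from multiplying by the given inverse.
    1-q^-cancelˡ : ∀ k {x y} → (1# - q^ suc k) * x ≈ (1# - q^ suc k) * y → x ≈ y
    1-q^-cancelˡ k {x} {y} eq = begin
      x                                         ≈⟨ expand x ⟩
      ι (suc k) * ((1# - q^ suc k) * x)         ≈⟨ *-congˡ eq ⟩
      ι (suc k) * ((1# - q^ suc k) * y)         ≈⟨ expand y ⟨
      y                                         ∎
      where
      expand : ∀ z → z ≈ ι (suc k) * ((1# - q^ suc k) * z)
      expand z = begin
        z                                       ≈⟨ *-identityˡ z ⟨
        1# * z                                  ≈⟨ *-congʳ (ι-inverse k) ⟨
        (1# - q^ suc k) * ι (suc k) * z         ≈⟨ solve 3 (λ a b c → a :* b :* c := b :* (a :* c)) refl _ _ _ ⟩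
        ι (suc k) * ((1# - q^ suc k) * z)       ∎

    poch : ℕ → ℕ → Carrier
    poch s zero    = 1#
    poch s (suc L) = poch s L * (1# - q^ (s ℕ.* suc L))

    ipoch : ℕ → ℕ → Carrier
    ipoch s zero    = 1#
    ipoch s (suc L) = ipoch s L * ι (s ℕ.* suc L)

    ι-inverse′ : ∀ s L → (1# - q^ (suc s ℕ.* suc L)) * ι (suc s ℕ.* suc L) ≈ 1#
    ι-inverse′ s L = ι-inverse (L ℕ.+ s ℕ.* suc L)

    ipoch-pred : ∀ s L → (1# - q^ (suc s ℕ.* suc L)) * ipoch (suc s) (suc L) ≈ ipoch (suc s) L
    ipoch-pred s L = begin
      (1# - q^ (suc s ℕ.* suc L)) * (ipoch (suc s) L * ι (suc s ℕ.* suc L))   ≈⟨ solve 3 (λ a b c → a :* (b :* c) := b :* (a :* c)) refl _ _ _ ⟩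
      ipoch (suc s) L * ((1# - q^ (suc s ℕ.* suc L)) * ι (suc s ℕ.* suc L))   ≈⟨ *-congˡ (ι-inverse′ s L) ⟩
      ipoch (suc s) L * 1#                                                    ≈⟨ *-identityʳ _ ⟩
      ipoch (suc s) L                                                         ∎

    poch*ipoch : ∀ s L → poch (suc s) L * ipoch (suc s) L ≈ 1#
    poch*ipoch s zero    = *-identityʳ 1#
    poch*ipoch s (suc L) = begin
      poch (suc s) L * (1# - q^ (suc s ℕ.* suc L)) * ipoch (suc s) (suc L)     ≈⟨ *-assoc _ _ _ ⟩
      poch (suc s) L * ((1# - q^ (suc s ℕ.* suc L)) * ipoch (suc s) (suc L))   ≈⟨ *-congˡ (ipoch-pred s L) ⟩
      poch (suc s) L * ipoch (suc s) L                                         ≈⟨ poch*ipoch s L ⟩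
      1#                                                                       ∎

    poch-suc₁ : ∀ L → poch 1 (suc L) ≈ poch 1 L * (1# - q^ suc L)
    poch-suc₁ L = *-congˡ (1-‿cong (q^-≡ (ℕₚ.*-identityˡ (suc L))))

    ipoch-pred₁ : ∀ L → (1# - q^ suc L) * ipoch 1 (suc L) ≈ ipoch 1 L
    ipoch-pred₁ L = trans (*-congʳ (1-‿cong (q^-≡ (≡.sym (ℕₚ.*-identityˡ (suc L)))))) (ipoch-pred 0 L)

    -- 1 / (q^s;q^s)_{r-j}, with the convention that it vanishes for j > r.
    ipochDiff : ℕ → ℕ → ℕ → Carrier
    ipochDiff s r       zero    = ipoch s r
    ipochDiff s zero    (suc j) = 0#
    ipochDiff s (suc r) (suc j) = ipochDiff s r j

    ipochDiff-+ : ∀ s k r j → ipochDiff s (k ℕ.+ r) (k ℕ.+ j) ≡ ipochDiff s r j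
    ipochDiff-+ s zero    r j = ≡.refl
    ipochDiff-+ s (suc k) r j = ipochDiff-+ s k r j

    ipochDiff-m+n-m : ∀ s m n → ipochDiff s (m ℕ.+ n) m ≡ ipoch s n
    ipochDiff-m+n-m s zero    n = ≡.refl
    ipochDiff-m+n-m s (suc m) n = ipochDiff-m+n-m s m n

    ipochDiff-< : ∀ s {r j} → r < j → ipochDiff s r j ≈ 0#
    ipochDiff-< s {zero}  {suc j} _         = refl
    ipochDiff-< s {suc r} {suc j} (s≤s r<j) = ipochDiff-< s r<j

    ipochDiff-≡ : ∀ s {r} j e → r ≡ j ℕ.+ e → ipochDiff s r j ≈ ipoch s e
    ipochDiff-≡ s j e ≡.refl = reflexive (ipochDiff-m+n-m s j e)

    q^3* : ∀ n → q^ (3 ℕ.* n) ≈ q^ n * q^ n * q^ n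
    q^3* n = begin
      q^ (n ℕ.+ (n ℕ.+ (n ℕ.+ 0)))     ≈⟨ q^-≡ (lemma n) ⟩
      q^ (n ℕ.+ n ℕ.+ n)               ≈⟨ q^-+ _ _ ⟩
      q^ (n ℕ.+ n) * q^ n              ≈⟨ *-congʳ (q^-+ _ _) ⟩
      q^ n * q^ n * q^ n               ∎
      where
      lemma : ∀ n → n ℕ.+ (n ℕ.+ (n ℕ.+ 0)) ≡ n ℕ.+ n ℕ.+ n
      lemma = ℕRing.solve-∀

    sgn : ℕ → Carrier
    sgn zero    = 1#
    sgn (suc j) = - sgn j

    -- The alternating sum with value 1 / (P²;P²)_r, where P = q^s.

    module _ (t : ℕ) where

      private
        s = suc t
        P : ℕ → Carrier
        P k = q^ (s ℕ.* k)

        P-≡ : ∀ {m n} → m ≡ n → P m ≈ P n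
        P-≡ m≡n = reflexive (≡.cong P m≡n)

        P-0 : P 0 ≈ 1#
        P-0 = trans (q^-≡ (ℕₚ.*-zeroʳ s)) q^-0

        P-+ : ∀ m n → P (m ℕ.+ n) ≈ P m * P n
        P-+ m n = trans (q^-≡ (ℕₚ.*-distribˡ-+ s m n)) (q^-+ _ _)

        P-suc : ∀ m → P (suc m) ≈ P 1 * P m
        P-suc = P-+ 1

      altTerm : ℕ → ℕ → Carrier
      altTerm r j = sgn j * P (j ℕ.* j) * (1# - P (suc (j ℕ.+ j))) *
                    (ipochDiff s r j * ipoch s (suc (r ℕ.+ j)))

      -- The Wilf–Zeilberger certificate of altTerm for r ↦ r + 1.
      altCertificate : ℕ → ℕ → Carrier
      altCertificate r j = sgn j * P (j ℕ.* j) * (P (suc r ∸ j) - P (suc r ℕ.+ j)) *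
                           (ipochDiff s (suc r) j * ipoch s (suc r ℕ.+ j))

      altTerm-vanish : ∀ {r j} → r < j → altTerm r j ≈ 0#
      altTerm-vanish r<j = trans (*-congˡ (trans (*-congʳ (ipochDiff-< s r<j)) (zeroˡ _))) (zeroʳ _)

      altCertificate-vanish : ∀ {r j} → suc r < j → altCertificate r j ≈ 0#
      altCertificate-vanish r<j = trans (*-congˡ (trans (*-congʳ (ipochDiff-< s r<j)) (zeroˡ _))) (zeroʳ _)

      -- For j ≤ r every reciprocal is a polynomial multiple of 1 / (P;P)_{r+1-j} or of 1 /
      -- (P;P)_{r+j+2}, so the recurrence becomes a polynomial identity. The truncated exponent in
      -- `altCertificate` does no harm, because `ipochDiff s (suc r) j` is 0 whenever j > r + 1.
      altTerm-step : ∀ r j →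
        (1# - P (2 ℕ.* suc r)) * altTerm (suc r) j + altCertificate r (suc j) ≈
        altTerm r j + altCertificate r j
      altTerm-step r j with ℕₚ.<-cmp j (suc r)
      ... | tri> _ _ r<j = begin
        (1# - P (2 ℕ.* suc r)) * altTerm (suc r) j + altCertificate r (suc j)
          ≈⟨ +-cong (trans (*-congˡ (altTerm-vanish r<j)) (zeroʳ _)) (altCertificate-vanish (ℕₚ.m<n⇒m<1+n r<j)) ⟩
        0# + 0#
          ≈⟨ +-cong (altTerm-vanish (ℕₚ.<⇒≤ r<j)) (altCertificate-vanish r<j) ⟨
        altTerm r j + altCertificate r j  ∎
      -- At the edge j = r + 1 the old summand and the next certificate are both 0. The new summand
      -- must equal the certificate by itself, and it does because 1 - P^{2j+1} cancels the last
      -- factor of the second reciprocal.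
      ... | tri≈ _ ≡.refl _ = begin
        (1# - P (2 ℕ.* j)) * altTerm j j + altCertificate r (suc j)
          ≈⟨ +-cong (*-cong (1-‿cong (P-≡ (≡.cong (j ℕ.+_) (ℕₚ.+-identityʳ j)))) refl) (altCertificate-vanish (ℕₚ.n<1+n j)) ⟩
        (1# - P (j ℕ.+ j)) * altTerm j j + 0#
          ≈⟨ solve 6 (λ w g b c d e → (𝟙 :- w) :* (g :* b :* c :* (d :* e)) :+ 𝟘
                := 𝟘 :+ g :* b :* (𝟙 :- w) :* (d :* (c :* e))) refl _ _ _ _ _ _ ⟩
        0# + sgn j * P (j ℕ.* j) * (1# - P (j ℕ.+ j)) * (ipochDiff s j j * ((1# - P (suc (j ℕ.+ j))) * ipoch s (suc (j ℕ.+ j))))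
          ≈⟨ +-cong (sym (altTerm-vanish (ℕₚ.n<1+n r)))
               (*-cong (*-congˡ (+-congʳ (sym (trans (P-≡ (ℕₚ.n∸n≡0 j)) P-0)))) (*-congˡ (ipoch-pred t (j ℕ.+ j)))) ⟩
        altTerm r j + altCertificate r j  ∎
      -- With r = j + e, all powers become monomials in Q = `P 1`, J = `P j`, E = `P e` and b =
      -- P^{j²}.
      ... | tri< (s≤s j≤r) _ _ with ℕₚ.m≤n⇒∃[o]m+o≡n j≤r
      ... | e , ≡.refl = begin
        (1# - P (2 ℕ.* suc r)) * altTerm (suc r) j + altCertificate r (suc j)
          ≈⟨ +-cong (*-cong (1-‿cong Pr²) (*-cong (*-congˡ (1-‿cong P2j+1)) (*-congʳ D↑)))
                    (*-cong (*-cong (*-congˡ Pj+1²) (+-cong Pr∸j (-‿cong Pr+j+2))) (*-cong D≈ (reflexive (≡.cong (ipoch s) (≡.cong suc (ℕₚ.+-suc r j)))))) ⟩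
        (1# - (Q * J * E) * (Q * J * E)) * (g * b * (1# - Q * (J * J)) * (U * V)) +
        (- g) * (b * (Q * (J * J))) * (E - (Q * J * E) * (Q * J)) * ((1# - Q * E) * U * V)
          ≈⟨ solve 7 (λ Q J E g b U V →
               (𝟙 :- (Q :* J :* E) :* (Q :* J :* E)) :* (g :* b :* (𝟙 :- Q :* (J :* J)) :* (U :* V)) :+
               (:- g) :* (b :* (Q :* (J :* J))) :* (E :- (Q :* J :* E) :* (Q :* J)) :* ((𝟙 :- Q :* E) :* U :* V)
               := g :* b :* (𝟙 :- Q :* (J :* J)) :* ((𝟙 :- Q :* E) :* U :* ((𝟙 :- (Q :* J :* E) :* (Q :* J)) :* V)) :+
                  g :* b :* (Q :* E :- (Q :* J :* E) :* J) :* (U :* ((𝟙 :- (Q :* J :* E) :* (Q :* J)) :* V)))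
               refl Q J E g b U V ⟩
        g * b * (1# - Q * (J * J)) * ((1# - Q * E) * U * ((1# - (Q * J * E) * (Q * J)) * V)) +
        g * b * (Q * E - (Q * J * E) * J) * (U * ((1# - (Q * J * E) * (Q * J)) * V))
          ≈⟨ +-cong (*-cong (*-congˡ (1-‿cong P2j+1)) (*-cong D≈ V↓))
                    (*-cong (*-congˡ (+-cong Pr+1∸j (-‿cong (P-+ (suc r) j ⟨≈⟩ *-congʳ Pr+1)))) (*-cong D↑ V↓)) ⟨
        altTerm r j + altCertificate r j  ∎
        where
        infixr 4 _⟨≈⟩_
        _⟨≈⟩_ = trans
        Q = P 1
        J = P j
        E = P e
        g = sgn j
        b = P (j ℕ.* j)
        U = ipoch s (suc e)
        V = ipoch s (suc (suc (r ℕ.+ j)))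
        Pr+1 : P (suc r) ≈ Q * J * E
        Pr+1 = P-suc r ⟨≈⟩ *-congˡ (P-+ j e) ⟨≈⟩ sym (*-assoc _ _ _)
        Pr² : P (2 ℕ.* suc r) ≈ (Q * J * E) * (Q * J * E)
        Pr² = P-≡ (≡.cong (suc r ℕ.+_) (ℕₚ.+-identityʳ (suc r))) ⟨≈⟩ P-+ _ _ ⟨≈⟩ *-cong Pr+1 Pr+1
        P2j+1 : P (suc (j ℕ.+ j)) ≈ Q * (J * J)
        P2j+1 = P-suc _ ⟨≈⟩ *-congˡ (P-+ j j)
        Pj+1² : P (suc j ℕ.* suc j) ≈ b * (Q * (J * J))
        Pj+1² = P-≡ (lemma j) ⟨≈⟩ P-+ _ _ ⟨≈⟩ *-congˡ P2j+1
          where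
          lemma : ∀ j → suc j ℕ.* suc j ≡ j ℕ.* j ℕ.+ suc (j ℕ.+ j)
          lemma = ℕRing.solve-∀
        Pr∸j : P (suc r ∸ suc j) ≈ E
        Pr∸j = P-≡ (ℕₚ.m+n∸m≡n j e)
        Pr+1∸j : P (suc r ∸ j) ≈ Q * E
        Pr+1∸j = P-≡ (≡.trans (≡.cong (_∸ j) (≡.sym (ℕₚ.+-suc j e))) (ℕₚ.m+n∸m≡n j (suc e))) ⟨≈⟩ P-suc e
        Pr+j+2 : P (suc r ℕ.+ suc j) ≈ (Q * J * E) * (Q * J)
        Pr+j+2 = P-+ (suc r) (suc j) ⟨≈⟩ *-cong Pr+1 (P-suc j)
        D↑ : ipochDiff s (suc r) j ≈ U
        D↑ = ipochDiff-≡ s j (suc e) (≡.sym (ℕₚ.+-suc j e))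
        D≈ : ipochDiff s r j ≈ (1# - Q * E) * U
        D≈ = ipochDiff-≡ s j e ≡.refl ⟨≈⟩ sym (*-congʳ (1-‿cong (sym (P-suc e))) ⟨≈⟩ ipoch-pred t e)
        V↓ : ipoch s (suc (r ℕ.+ j)) ≈ (1# - (Q * J * E) * (Q * J)) * V
        V↓ = sym (*-congʳ (1-‿cong (sym (P-≡ (≡.cong suc (≡.sym (ℕₚ.+-suc r j))) ⟨≈⟩ Pr+j+2))) ⟨≈⟩ ipoch-pred t (suc (r ℕ.+ j)))

      sum-altTerm : ∀ r B → r < B → sum (altTerm r) B ≈ ipoch (2 ℕ.* s) r
      sum-altTerm zero (suc B) _ = begin
        sum (altTerm 0) (suc B)                     ≈⟨ sum-head (altTerm 0) B (λ i → altTerm-vanish z<s) ⟩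
        1# * P 0 * (1# - P 1) * (1# * ipoch s 1)    ≈⟨ solve 3 (λ z d u → 𝟙 :* z :* d :* (𝟙 :* u) := z :* (d :* u)) refl _ _ _ ⟩
        P 0 * ((1# - P 1) * ipoch s 1)              ≈⟨ *-cong P-0 (ipoch-pred t 0) ⟩
        1# * 1#                                     ≈⟨ *-identityʳ 1# ⟩
        1#                                          ∎
      -- The argument is chosen so that its successor is definitionally 2s(r+1).
      sum-altTerm (suc r) B r<B = 1-q^-cancelˡ (r ℕ.+ ℕ.pred (2 ℕ.* s) ℕ.* suc r) (begin
        (1# - q^ (2 ℕ.* s ℕ.* suc r)) * sum (altTerm (suc r)) B    ≈⟨ *-congʳ (1-‿cong (q^-≡ (lemma s (suc r)))) ⟩
        (1# - P (2 ℕ.* suc r)) * sum (altTerm (suc r)) B           ≈⟨ sum-*ˡ _ _ B ⟨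
        sum (λ j → (1# - P (2 ℕ.* suc r)) * altTerm (suc r) j) B   ≈⟨ sum-telescope (altCertificate r) B (altTerm-step r) certificate-0 (altCertificate-vanish r<B) ⟩
        sum (altTerm r) B                                          ≈⟨ sum-altTerm r B (ℕₚ.<-trans (ℕₚ.n<1+n r) r<B) ⟩
        ipoch (2 ℕ.* s) r                                          ≈⟨ ipoch-pred (ℕ.pred (2 ℕ.* s)) r ⟨
        (1# - q^ (2 ℕ.* s ℕ.* suc r)) * ipoch (2 ℕ.* s) (suc r)    ∎)
        where
        lemma : ∀ a b → 2 ℕ.* a ℕ.* b ≡ a ℕ.* (2 ℕ.* b)
        lemma = ℕRing.solve-∀
        certificate-0 : altCertificate r 0 ≈ 0#
        certificate-0 = begin
          1# * P 0 * (P (suc r) - P (suc r ℕ.+ 0)) * (ipoch s (suc r) * ipoch s (suc r ℕ.+ 0))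
            ≈⟨ *-congʳ (*-congˡ (+-congˡ (-‿cong (P-≡ (ℕₚ.+-identityʳ (suc r)))))) ⟩
          1# * P 0 * (P (suc r) - P (suc r)) * (ipoch s (suc r) * ipoch s (suc r ℕ.+ 0))
            ≈⟨ solve 4 (λ z x u v → 𝟙 :* z :* (x :- x) :* (u :* v) := 𝟘) refl _ _ _ _ ⟩
          0#  ∎

    -- The cubic sum and its recurrence in N.

    module _ (m : ℕ) where

      cubicTerm : ℕ → ℕ → Carrier
      cubicTerm N s =
        q^ (3 ℕ.* s ℕ.* s ℕ.+ 3 ℕ.* m ℕ.* s) * poch 3 (m ℕ.+ N ∸ suc s) * ipochDiff 1 N (3 ℕ.* s) *
        (ipoch 3 s * ipoch 3 (s ℕ.+ m))

      -- The Wilf–Zeilberger certificate of cubicTerm for N ↦ N + 1.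
      cubicCertificate : ℕ → ℕ → Carrier
      cubicCertificate N s =
        q^ (suc N ∸ 3 ℕ.* s) *
        (q^ (3 ℕ.* s ℕ.* s ℕ.+ 3 ℕ.* m ℕ.* s) * poch 3 (m ℕ.+ N ∸ s) * ipochDiff 1 (suc N) (3 ℕ.* s) *
         ((1# - q^ (3 ℕ.* s)) * ipoch 3 s * ((1# - q^ (3 ℕ.* (s ℕ.+ m))) * ipoch 3 (s ℕ.+ m))))

      cubicTerm-vanish : ∀ {N s} → N < 3 ℕ.* s → cubicTerm N s ≈ 0#
      cubicTerm-vanish N<3s =
        trans (*-congʳ (trans (*-congˡ (ipochDiff-< 1 N<3s)) (zeroʳ _))) (zeroˡ _)

      cubicCertificate-vanish : ∀ {N s} → suc N < 3 ℕ.* s → cubicCertificate N s ≈ 0#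
      cubicCertificate-vanish N<3s =
        trans (*-congˡ (trans (*-congʳ (trans (*-congˡ (ipochDiff-< 1 N<3s)) (zeroʳ _))) (zeroˡ _))) (zeroʳ _)

      cubicCertificate-0 : ∀ N → cubicCertificate N 0 ≈ 0#
      cubicCertificate-0 N = trans
        (*-congˡ (*-congˡ (*-congʳ (*-congʳ 1-q^0))))
        (solve 4 (λ a b c d → a :* (b :* (𝟘 :* c :* d)) := 𝟘) refl _ _ _ _)

      private
        3s<3[1+s] : ∀ s → 3 ℕ.* s < 3 ℕ.* suc s
        3s<3[1+s] s = ℕₚ.*-monoʳ-< 3 (ℕₚ.n<1+n s)

        N+1+3m : ∀ {N} s → suc N ≡ 3 ℕ.* s → suc (N ℕ.+ 3 ℕ.* m) ≡ 3 ℕ.* (s ℕ.+ m)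
        N+1+3m s eq = ≡.trans (≡.cong (ℕ._+ 3 ℕ.* m) eq) (≡.sym (ℕₚ.*-distribˡ-+ 3 s m))

        -- q^{e+1} / (q;q)_{e-2}, rewritten so that no exponent is negative for e ≤ 1.
        tail-factor : ∀ e → q^ 3 * q^ (suc e ∸ 3) * ipochDiff 1 (suc e) 3 ≈
                      (q^ suc e - q^ (e ℕ.+ e)) * ((1# - q^ e) * ipoch 1 e)
        tail-factor zero = begin
          q^ 3 * q^ 0 * 0#                                      ≈⟨ solve 4 (λ a b c d → a :* b :* 𝟘 := c :* (𝟘 :* d)) refl _ _ _ _ ⟩
          (q^ 1 - q^ 0) * (0# * ipoch 1 0)                      ≈⟨ *-congˡ (*-congʳ 1-q^0) ⟨
          (q^ 1 - q^ 0) * ((1# - q^ 0) * ipoch 1 0)             ∎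
        tail-factor (suc zero) =
          solve 4 (λ a b c d → a :* b :* 𝟘 := (c :- c) :* d) refl _ _ _ _
        tail-factor (suc (suc e)) = begin
          q^ 3 * q^ e * ipoch 1 e
            ≈⟨ *-cong (trans (sym (q^-+ 3 e)) (q^-suc _)) (sym (ipoch-pred₁ e)) ⟩
          q^ 1 * q^ suc (suc e) * ((1# - q^ suc e) * ipoch 1 (suc e))
            ≈⟨ solve 4 (λ q x y u → q :* x :* ((𝟙 :- y) :* u) := (q :* x :- q :* y :* x) :* u) refl _ _ _ _ ⟩
          (q^ 1 * q^ suc (suc e) - q^ 1 * q^ suc e * q^ suc (suc e)) * ipoch 1 (suc e)
            ≈⟨ *-cong (+-cong (sym (q^-suc _)) (-‿cong (trans (*-congʳ (sym (q^-suc (suc e)))) (sym (q^-+ _ _))))) (sym (ipoch-pred₁ (suc e))) ⟩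
          (q^ suc (suc (suc e)) - q^ (suc (suc e) ℕ.+ suc (suc e))) * ((1# - q^ suc (suc e)) * ipoch 1 (suc (suc e)))  ∎

      -- For N = 3s + e the reciprocals reduce to 1 / (q;q)_{e+1}, 1 / (Q;Q)_s and 1 / (Q;Q)_{s+m};
      -- what remains is a polynomial identity in q, q^e, q^{3s} and q^{3m}. In the certificate, the
      -- factors 1 - q^{3s} and 1 - q^{3(s+m)} force the value 0 at s = 0 and shorten the last two
      -- reciprocals at s + 1.
      cubicTerm-step : ∀ N s → 1 ≤ m ℕ.+ N →
        (1# - q^ suc N) * (1# - q^ suc (N ℕ.+ 3 ℕ.* m)) * cubicTerm (suc N) s + cubicCertificate N (suc s) ≈
        (1# - q^ (2 ℕ.* N ℕ.+ 3 ℕ.* m)) * (1# - q^ suc (2 ℕ.* N ℕ.+ 3 ℕ.* m)) * cubicTerm N s + cubicCertificate N s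
      cubicTerm-step N s 1≤m+N with ℕₚ.<-cmp (suc N) (3 ℕ.* s)
      ... | tri< N<3s _ _ = begin
        (1# - q^ suc N) * (1# - q^ suc (N ℕ.+ 3 ℕ.* m)) * cubicTerm (suc N) s + cubicCertificate N (suc s)
          ≈⟨ +-cong (trans (*-congˡ (cubicTerm-vanish N<3s)) (zeroʳ _)) (cubicCertificate-vanish {s = suc s} (ℕₚ.<-trans N<3s (3s<3[1+s] s))) ⟩
        0# + 0#
          ≈⟨ +-cong (trans (*-congˡ (cubicTerm-vanish (ℕₚ.<⇒≤ N<3s))) (zeroʳ _)) (cubicCertificate-vanish N<3s) ⟨
        (1# - q^ (2 ℕ.* N ℕ.+ 3 ℕ.* m)) * (1# - q^ suc (2 ℕ.* N ℕ.+ 3 ℕ.* m)) * cubicTerm N s + cubicCertificate N s  ∎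
      -- At the edge N + 1 = 3s only the new summand and the certificate at s survive. The two
      -- prefactors of the summand are then exactly the two extra factors of the certificate, whose
      -- leading power of q is q^0.
      ... | tri≈ _ N+1≡3s _ = begin
        (1# - q^ suc N) * (1# - q^ suc (N ℕ.+ 3 ℕ.* m)) * cubicTerm (suc N) s + cubicCertificate N (suc s)
          ≈⟨ +-cong (*-cong (*-cong (1-‿cong (q^-≡ N+1≡3s)) (1-‿cong (q^-≡ (N+1+3m s N+1≡3s))))
                            (*-congʳ (*-congʳ (*-congˡ (reflexive (≡.cong (λ k → poch 3 (k ∸ suc s)) (ℕₚ.+-suc m N)))))))
                    (cubicCertificate-vanish {s = suc s} (≡.subst (_< 3 ℕ.* suc s) (≡.sym N+1≡3s) (3s<3[1+s] s))) ⟩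
        (1# - q^ (3 ℕ.* s)) * (1# - q^ (3 ℕ.* (s ℕ.+ m))) * (z * p * d * (v * w)) + 0#
          ≈⟨ solve 7 (λ x y z p d v w → (𝟙 :- x) :* (𝟙 :- y) :* (z :* p :* d :* (v :* w)) :+ 𝟘
                       := 𝟘 :+ 𝟙 :* (z :* p :* d :* ((𝟙 :- x) :* v :* ((𝟙 :- y) :* w)))) refl _ _ z p d v w ⟩
        0# + 1# * (z * p * d * ((1# - q^ (3 ℕ.* s)) * v * ((1# - q^ (3 ℕ.* (s ℕ.+ m))) * w)))
          ≈⟨ +-cong (trans (*-congˡ (cubicTerm-vanish (ℕₚ.≤-reflexive N+1≡3s))) (zeroʳ _))
                    (*-congʳ (trans (q^-≡ (≡.trans (≡.cong (_∸ 3 ℕ.* s) N+1≡3s) (ℕₚ.n∸n≡0 (3 ℕ.* s)))) q^-0)) ⟨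
        (1# - q^ (2 ℕ.* N ℕ.+ 3 ℕ.* m)) * (1# - q^ suc (2 ℕ.* N ℕ.+ 3 ℕ.* m)) * cubicTerm N s + cubicCertificate N s  ∎
        where
        z = q^ (3 ℕ.* s ℕ.* s ℕ.+ 3 ℕ.* m ℕ.* s)
        p = poch 3 (m ℕ.+ N ∸ s)
        d = ipochDiff 1 (suc N) (3 ℕ.* s)
        v = ipoch 3 s
        w = ipoch 3 (s ℕ.+ m)
      ... | tri> _ _ (s≤s 3s≤N) with ℕₚ.m≤n⇒∃[o]m+o≡n 3s≤N
      ... | e , ≡.refl = begin
        (1# - q^ suc N) * (1# - q^ suc (N ℕ.+ 3 ℕ.* m)) * cubicTerm (suc N) s + cubicCertificate N (suc s)
          ≈⟨ +-cong (*-cong (*-cong (1-‿cong qN+1) (1-‿cong qN+1+3m))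
                            (*-congʳ (*-cong (*-congˡ poch↑) D↑)))
                    (*-cong (q^-≡ exponent∸)
                            (*-cong (*-cong (*-cong qZ′ (reflexive (≡.cong (poch 3) m+N∸[1+s]))) D↓)
                                    (*-cong (ipoch-pred 2 s) (ipoch-pred 2 (s ℕ.+ m))))) ⟩
        (1# - q * a * x) * (1# - q * a * x * y) * (z * (p * (1# - y * (a * a * a) * (x * x))) * U * V) +
        t * (z * (q³ * (x * x) * y) * p * D * V)
          ≈⟨ +-congˡ (solve 8 (λ t z q³ x y p D V →
                t :* (z :* (q³ :* (x :* x) :* y) :* p :* D :* V) := q³ :* t :* D :* (z :* (x :* x :* y) :* p :* V)) refl _ _ _ _ _ _ _ _) ⟩
        (1# - q * a * x) * (1# - q * a * x * y) * (z * (p * (1# - y * (a * a * a) * (x * x))) * U * V) +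
        q³ * t * D * (z * (x * x * y) * p * V)
          -- Only `t` and `D` can still truncate, namely for e ≤ 1. `tail-factor` trades them for a
          -- polynomial multiple of `U`, uniformly in e.
          ≈⟨ +-congˡ (*-congʳ (trans (tail-factor e) (*-cong (+-cong (q^-suc e) (-‿cong (q^-+ e e))) (*-congˡ u↓)))) ⟩
        (1# - q * a * x) * (1# - q * a * x * y) * (z * (p * (1# - y * (a * a * a) * (x * x))) * U * V) +
        (q * a - a * a) * ((1# - a) * ((1# - q * a) * U)) * (z * (x * x * y) * p * V)
          ≈⟨ solve 9 (λ q a x y z p U v w →
               (𝟙 :- q :* a :* x) :* (𝟙 :- q :* a :* x :* y) :* (z :* (p :* (𝟙 :- y :* (a :* a :* a) :* (x :* x))) :* U :* (v :* w)) :+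
               (q :* a :- a :* a) :* ((𝟙 :- a) :* ((𝟙 :- q :* a) :* U)) :* (z :* (x :* x :* y) :* p :* (v :* w))
               := (𝟙 :- a :* a :* (x :* x) :* y) :* (𝟙 :- q :* (a :* a :* (x :* x) :* y)) :* (z :* p :* ((𝟙 :- q :* a) :* U) :* (v :* w)) :+
                  q :* a :* (z :* (p :* (𝟙 :- y :* (a :* a :* a) :* (x :* x))) :* U :* ((𝟙 :- x) :* v :* ((𝟙 :- x :* y) :* w))))
               refl q a x y z p U v w ⟩
        (1# - a * a * (x * x) * y) * (1# - q * (a * a * (x * x) * y)) * (z * p * ((1# - q * a) * U) * V) +
        q * a * (z * (p * (1# - y * (a * a * a) * (x * x))) * U * ((1# - x) * v * ((1# - x * y) * w)))
          ≈⟨ +-cong (*-cong (*-cong (1-‿cong q2N+3m) (1-‿cong (trans (q^-suc _) (*-congˡ q2N+3m))))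
                            (*-congʳ (*-cong (*-congˡ (reflexive (≡.cong (poch 3) m+N∸[1+s]))) (trans (reflexive (ipochDiff-m+n-m 1 (3 ℕ.* s) e)) u↓))))
                    (*-cong (trans (q^-≡ exponent∸₀) (q^-suc e))
                            (*-cong (*-cong (*-congˡ poch↑₀) D↑)
                                    (*-congˡ (*-congʳ (1-‿cong (trans (q^-≡ (ℕₚ.*-distribˡ-+ 3 s m)) (q^-+ _ _))))))) ⟨
        (1# - q^ (2 ℕ.* N ℕ.+ 3 ℕ.* m)) * (1# - q^ suc (2 ℕ.* N ℕ.+ 3 ℕ.* m)) * cubicTerm N s + cubicCertificate N s  ∎
        where
        infixr 4 _⟨≈⟩_
        _⟨≈⟩_ = trans
        q = q^ 1
        a = q^ e
        x = q^ (3 ℕ.* s)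
        y = q^ (3 ℕ.* m)
        z = q^ (3 ℕ.* s ℕ.* s ℕ.+ 3 ℕ.* m ℕ.* s)
        q³ = q^ 3
        k = ℕ.pred (m ℕ.+ e ℕ.+ 2 ℕ.* s)
        p = poch 3 k
        t = q^ (suc e ∸ 3)
        D = ipochDiff 1 (suc e) 3
        U = ipoch 1 (suc e)
        v = ipoch 3 s
        w = ipoch 3 (s ℕ.+ m)
        V = v * w

        -- The predecessor in `k` must not truncate, since (Q;Q)_{k+1} is to be split into (Q;Q)_k
        -- and one more factor. Here m + e + 2s = 0 would force m = N = 0, against `1≤m+N`.
        k+1 : suc k ≡ m ℕ.+ e ℕ.+ 2 ℕ.* s
        k+1 = ℕₚ.suc-pred (m ℕ.+ e ℕ.+ 2 ℕ.* s) {{ℕ.≢-nonZero nonzero}}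
          where
          nonzero : m ℕ.+ e ℕ.+ 2 ℕ.* s ≢ 0
          nonzero sum≡0 = ℕₚ.<⇒≢ 1≤m+N (≡.sym (≡.cong₂ ℕ._+_ m≡0 (≡.cong₂ ℕ._+_ (≡.cong (3 ℕ.*_) s≡0) e≡0)))
            where
            m+e≡0 = ℕₚ.m+n≡0⇒m≡0 (m ℕ.+ e) sum≡0
            m≡0 = ℕₚ.m+n≡0⇒m≡0 m m+e≡0
            e≡0 = ℕₚ.m+n≡0⇒n≡0 m m+e≡0
            s≡0 = ℕₚ.m+n≡0⇒m≡0 s (ℕₚ.m+n≡0⇒n≡0 (m ℕ.+ e) sum≡0)

        m+N : m ℕ.+ N ≡ s ℕ.+ suc k
        m+N = ≡.trans (lemma m s e) (≡.cong (s ℕ.+_) (≡.sym k+1))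
          where
          lemma : ∀ m s e → m ℕ.+ (3 ℕ.* s ℕ.+ e) ≡ s ℕ.+ (m ℕ.+ e ℕ.+ 2 ℕ.* s)
          lemma = ℕRing.solve-∀

        m+N∸s : m ℕ.+ N ∸ s ≡ suc k
        m+N∸s = ≡.trans (≡.cong (_∸ s) m+N) (ℕₚ.m+n∸m≡n s (suc k))

        m+N∸[1+s] : m ℕ.+ N ∸ suc s ≡ k
        m+N∸[1+s] = ≡.trans (≡.cong (_∸ suc s) (≡.trans m+N (ℕₚ.+-suc s k))) (ℕₚ.m+n∸m≡n s k)

        poch-[1+k] : poch 3 (suc k) ≈ p * (1# - y * (a * a * a) * (x * x))
        poch-[1+k] = *-congˡ (1-‿cong (q^-≡ (≡.trans (≡.cong (3 ℕ.*_) k+1) (lemma m e s)) ⟨≈⟩ q^-+ _ _ ⟨≈⟩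
                       *-cong (q^-+ _ _ ⟨≈⟩ *-congˡ (q^3* e)) (q^-+ _ _)))
          where
          lemma : ∀ m e s → 3 ℕ.* (m ℕ.+ e ℕ.+ 2 ℕ.* s) ≡ 3 ℕ.* m ℕ.+ 3 ℕ.* e ℕ.+ (3 ℕ.* s ℕ.+ 3 ℕ.* s)
          lemma = ℕRing.solve-∀

        poch↑₀ : poch 3 (m ℕ.+ N ∸ s) ≈ p * (1# - y * (a * a * a) * (x * x))
        poch↑₀ = trans (reflexive (≡.cong (poch 3) m+N∸s)) poch-[1+k]

        poch↑ : poch 3 (m ℕ.+ suc N ∸ suc s) ≈ p * (1# - y * (a * a * a) * (x * x))
        poch↑ = trans (reflexive (≡.cong (λ i → poch 3 (i ∸ suc s)) (ℕₚ.+-suc m N))) poch↑₀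

        D↑ : ipochDiff 1 (suc N) (3 ℕ.* s) ≈ U
        D↑ = ipochDiff-≡ 1 (3 ℕ.* s) (suc e) (≡.sym (ℕₚ.+-suc (3 ℕ.* s) e))

        3[1+s] : 3 ℕ.* suc s ≡ 3 ℕ.* s ℕ.+ 3
        3[1+s] = ≡.trans (ℕₚ.*-suc 3 s) (ℕₚ.+-comm 3 (3 ℕ.* s))

        D↓ : ipochDiff 1 (suc N) (3 ℕ.* suc s) ≈ D
        D↓ = reflexive (≡.trans (≡.cong₂ (ipochDiff 1) (≡.sym (ℕₚ.+-suc (3 ℕ.* s) e)) 3[1+s])
                                (ipochDiff-+ 1 (3 ℕ.* s) (suc e) 3))

        u↓ : ipoch 1 e ≈ (1# - q * a) * U
        u↓ = sym (*-congʳ (1-‿cong (sym (q^-suc e))) ⟨≈⟩ ipoch-pred₁ e)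

        exponent∸ : suc N ∸ 3 ℕ.* suc s ≡ suc e ∸ 3
        exponent∸ = ≡.trans (≡.cong₂ _∸_ (≡.sym (ℕₚ.+-suc (3 ℕ.* s) e)) 3[1+s])
                            (ℕₚ.[m+n]∸[m+o]≡n∸o (3 ℕ.* s) (suc e) 3)

        exponent∸₀ : suc N ∸ 3 ℕ.* s ≡ suc e
        exponent∸₀ = ≡.trans (≡.cong (_∸ 3 ℕ.* s) (≡.sym (ℕₚ.+-suc (3 ℕ.* s) e))) (ℕₚ.m+n∸m≡n (3 ℕ.* s) (suc e))

        qN+1 : q^ suc N ≈ q * a * x
        qN+1 = q^-suc N ⟨≈⟩ *-congˡ (q^-+ _ _ ⟨≈⟩ *-comm _ _) ⟨≈⟩ sym (*-assoc _ _ _)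

        qN+1+3m : q^ suc (N ℕ.+ 3 ℕ.* m) ≈ q * a * x * y
        qN+1+3m = q^-+ (suc N) (3 ℕ.* m) ⟨≈⟩ *-congʳ qN+1

        q2N+3m : q^ (2 ℕ.* N ℕ.+ 3 ℕ.* m) ≈ a * a * (x * x) * y
        q2N+3m = q^-≡ (lemma s e (3 ℕ.* m)) ⟨≈⟩ q^-+ _ _ ⟨≈⟩ *-congʳ (q^-+ _ _ ⟨≈⟩ *-cong (q^-+ _ _) (q^-+ _ _))
          where
          lemma : ∀ s e b → 2 ℕ.* (3 ℕ.* s ℕ.+ e) ℕ.+ b ≡ e ℕ.+ e ℕ.+ (3 ℕ.* s ℕ.+ 3 ℕ.* s) ℕ.+ b
          lemma = ℕRing.solve-∀

        qZ′ : q^ (3 ℕ.* suc s ℕ.* suc s ℕ.+ 3 ℕ.* m ℕ.* suc s) ≈ z * (q³ * (x * x) * y)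
        qZ′ = q^-≡ (lemma m s) ⟨≈⟩ q^-+ _ _ ⟨≈⟩ *-congˡ (q^-+ _ _ ⟨≈⟩ *-congʳ (q^-+ _ _ ⟨≈⟩ *-congˡ (q^-+ _ _)))
          where
          lemma : ∀ m s → 3 ℕ.* suc s ℕ.* suc s ℕ.+ 3 ℕ.* m ℕ.* suc s ≡
                  3 ℕ.* s ℕ.* s ℕ.+ 3 ℕ.* m ℕ.* s ℕ.+ (3 ℕ.+ (3 ℕ.* s ℕ.+ 3 ℕ.* s) ℕ.+ 3 ℕ.* m)
          lemma = ℕRing.solve-∀

    -- A cubic instance of the q-Pfaff–Saalschütz sum.
    CubicSum : ℕ → ℕ → ℕ → Set ℓ
    CubicSum m B N = (1# - q^ (2 ℕ.* N ℕ.+ 3 ℕ.* m)) * sum (cubicTerm m N) B ≈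
                     poch 1 (2 ℕ.* N ℕ.+ 3 ℕ.* m) * (ipoch 1 N * ipoch 1 (N ℕ.+ 3 ℕ.* m))

    -- With κ = 2N + 3m, the recurrence multiplies the bare sum by (1 - q^κ)(1 - q^{κ+1}) over (1 -
    -- q^{N+1})(1 - q^{N+3m+1}). The prefactor changes from 1 - q^κ to 1 - q^{κ+2}, so the product
    -- side gains exactly the next two factors of (q;q)_κ. The bound `suc N < 3 * B` makes the
    -- certificate vanish at `B`.
    cubicSum-suc : ∀ m B N → 1 ≤ m ℕ.+ N → suc N < 3 ℕ.* B → CubicSum m B N → CubicSum m B (suc N)
    cubicSum-suc m B N 1≤m+N N<3B IH = 1-q^-cancelˡ N (1-q^-cancelˡ (N ℕ.+ 3 ℕ.* m) (begin
      (1# - α₂) * ((1# - α₁) * ((1# - q^ (2 ℕ.* suc N ℕ.+ 3 ℕ.* m)) * S′))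
        ≈⟨ *-congˡ (*-congˡ (*-congʳ (1-‿cong (q^-≡ κ+2)))) ⟩
      (1# - α₂) * ((1# - α₁) * ((1# - q^ suc (suc κ)) * S′))
        ≈⟨ solve 4 (λ x y z s → (𝟙 :- x) :* ((𝟙 :- y) :* ((𝟙 :- z) :* s)) := (𝟙 :- z) :* ((𝟙 :- y) :* (𝟙 :- x) :* s)) refl _ _ _ _ ⟩
      (1# - q^ suc (suc κ)) * ((1# - α₁) * (1# - α₂) * S′)
        ≈⟨ *-congˡ recurrence ⟩
      (1# - q^ suc (suc κ)) * ((1# - q^ κ) * (1# - q^ suc κ) * S)
        ≈⟨ solve 4 (λ x y z s → (𝟙 :- x) :* ((𝟙 :- y) :* (𝟙 :- z) :* s) := (𝟙 :- x) :* (𝟙 :- z) :* ((𝟙 :- y) :* s)) refl _ _ _ _ ⟩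
      (1# - q^ suc (suc κ)) * (1# - q^ suc κ) * ((1# - q^ κ) * S)
        ≈⟨ *-congˡ IH ⟩
      (1# - q^ suc (suc κ)) * (1# - q^ suc κ) * (poch 1 κ * (ipoch 1 N * ipoch 1 (N ℕ.+ 3 ℕ.* m)))
        ≈⟨ *-congˡ (*-congˡ (*-cong (ipoch-pred₁ N) (ipoch-pred₁ (N ℕ.+ 3 ℕ.* m)))) ⟨
      (1# - q^ suc (suc κ)) * (1# - q^ suc κ) * (poch 1 κ * ((1# - α₁) * u * ((1# - α₂) * v)))
        ≈⟨ solve 7 (λ x y p a b u v → (𝟙 :- x) :* (𝟙 :- y) :* (p :* ((𝟙 :- a) :* u :* ((𝟙 :- b) :* v)))
                := (𝟙 :- b) :* ((𝟙 :- a) :* (p :* (𝟙 :- y) :* (𝟙 :- x) :* (u :* v)))) refl _ _ _ _ _ _ _ ⟩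
      (1# - α₂) * ((1# - α₁) * (poch 1 κ * (1# - q^ suc κ) * (1# - q^ suc (suc κ)) * (u * v)))
        ≈⟨ *-congˡ (*-congˡ (*-congʳ (trans (poch-suc₁ (suc κ)) (*-congʳ (poch-suc₁ κ))))) ⟨
      (1# - α₂) * ((1# - α₁) * (poch 1 (suc (suc κ)) * (u * v)))
        ≈⟨ *-congˡ (*-congˡ (*-congʳ (reflexive (≡.cong (poch 1) κ+2)))) ⟨
      (1# - α₂) * ((1# - α₁) * (poch 1 (2 ℕ.* suc N ℕ.+ 3 ℕ.* m) * (u * v)))  ∎))
      where
      κ = 2 ℕ.* N ℕ.+ 3 ℕ.* m
      κ+2 : 2 ℕ.* suc N ℕ.+ 3 ℕ.* m ≡ suc (suc κ)
      κ+2 = ≡.cong (ℕ._+ 3 ℕ.* m) (ℕₚ.*-suc 2 N)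
      α₁ = q^ suc N
      α₂ = q^ suc (N ℕ.+ 3 ℕ.* m)
      S = sum (cubicTerm m N) B
      S′ = sum (cubicTerm m (suc N)) B
      u = ipoch 1 (suc N)
      v = ipoch 1 (suc (N ℕ.+ 3 ℕ.* m))
      recurrence : (1# - α₁) * (1# - α₂) * S′ ≈ (1# - q^ κ) * (1# - q^ suc κ) * S
      recurrence = trans (sym (sum-*ˡ _ _ B)) (trans
        (sum-telescope (cubicCertificate m N) B (λ s → cubicTerm-step m N s 1≤m+N)
                       (cubicCertificate-0 m N) (cubicCertificate-vanish m N<3B))
        (sum-*ˡ _ _ B))

    -- The induction starts at N = 0 for m > 0 but at N = 1 for m = 0: at m = N = 0 the prefactor is
    -- 1 - q^0, and the formula would read 0 = 1.
    cubicSum : ∀ m B N → 1 ≤ m ℕ.+ N → N < 3 ℕ.* B → CubicSum m B N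
    cubicSum zero B (suc (suc N)) _ N<3B =
      cubicSum-suc 0 B (suc N) (s≤s z≤n) N<3B (cubicSum 0 B (suc N) (s≤s z≤n) (ℕₚ.<⇒≤ N<3B))
    cubicSum (suc m) B (suc N) _ N<3B =
      cubicSum-suc (suc m) B N (s≤s z≤n) N<3B (cubicSum (suc m) B N (s≤s z≤n) (ℕₚ.<⇒≤ N<3B))
    cubicSum zero (suc B) 1 _ _ = begin
      (1# - q^ 2) * sum (cubicTerm 0 1) (suc B)
        ≈⟨ *-congˡ (sum-head (cubicTerm 0 1) B (λ s → cubicTerm-vanish 0 {1} {suc s} (ℕₚ.<⇒≤ (ℕₚ.*-monoʳ-≤ 3 {1} {suc s} (s≤s z≤n))))) ⟩
      (1# - q^ 2) * (q^ 0 * 1# * ipoch 1 1 * (1# * 1#))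
        ≈⟨ *-congˡ (*-congʳ (*-congʳ (*-congʳ q^-0))) ⟩
      (1# - q^ 2) * (1# * 1# * ipoch 1 1 * (1# * 1#))
        ≈⟨ solve 2 (λ x u → (𝟙 :- x) :* (𝟙 :* 𝟙 :* u :* (𝟙 :* 𝟙)) := 𝟙 :* ((𝟙 :- x) :* u)) refl _ _ ⟩
      1# * ((1# - q^ 2) * ipoch 1 1)
        ≈⟨ *-congʳ (poch*ipoch 0 1) ⟨
      poch 1 1 * ipoch 1 1 * ((1# - q^ 2) * ipoch 1 1)
        ≈⟨ solve 3 (λ p x u → p :* u :* ((𝟙 :- x) :* u) := p :* (𝟙 :- x) :* (u :* u)) refl _ _ _ ⟩
      poch 1 2 * (ipoch 1 1 * ipoch 1 1)  ∎
    cubicSum m@(suc m-1) (suc B) zero _ _ = begin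
      (1# - q^ (3 ℕ.* m)) * sum (cubicTerm m 0) (suc B)
        ≈⟨ *-congˡ (sum-head (cubicTerm m 0) B (λ s → cubicTerm-vanish m {0} {suc s} z<s)) ⟩
      (1# - q^ (3 ℕ.* m)) * (q^ (3 ℕ.* m ℕ.* 0) * poch 3 (m-1 ℕ.+ 0) * 1# * (1# * ipoch 3 m))
        ≈⟨ *-congˡ (*-congʳ (*-congʳ (*-cong (trans (q^-≡ (ℕₚ.*-zeroʳ (3 ℕ.* m))) q^-0) (reflexive (≡.cong (poch 3) (ℕₚ.+-identityʳ m-1)))))) ⟩
      (1# - q^ (3 ℕ.* m)) * (1# * poch 3 m-1 * 1# * (1# * ipoch 3 m))
        ≈⟨ solve 3 (λ x p u → (𝟙 :- x) :* (𝟙 :* p :* 𝟙 :* (𝟙 :* u)) := p :* (𝟙 :- x) :* u) refl _ _ _ ⟩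
      poch 3 m * ipoch 3 m
        ≈⟨ trans (poch*ipoch 2 m) (sym (poch*ipoch 0 (3 ℕ.* m))) ⟩
      poch 1 (3 ℕ.* m) * ipoch 1 (3 ℕ.* m)
        ≈⟨ *-congˡ (*-identityˡ _) ⟨
      poch 1 (3 ℕ.* m) * (1# * ipoch 1 (3 ℕ.* m))  ∎

    -- Exchange of summations, and expansion of the q-binomials in the kernel.

    sum-exchange : ∀ x (γ w Y E : ℕ → Carrier) (K : ℕ → ℕ → Carrier) B →
      (∀ j → x * sum (λ r → γ r * K r j) B ≈ Y j) →
      (∀ r → r < B → sum (λ j → w j * K r j) B ≈ E r) →
      sum (λ j → w j * Y j) B ≈ x * sum (λ r → γ r * E r) B
    sum-exchange x γ w Y E K B expand evaluate = begin
      sum (λ j → w j * Y j) B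
        ≈⟨ sum-cong B (λ j _ → *-congˡ (expand j)) ⟨
      sum (λ j → w j * (x * sum (λ r → γ r * K r j) B)) B
        ≈⟨ sum-cong B (λ j _ → solve 3 (λ a b s → a :* (b :* s) := b :* (a :* s)) refl _ _ _) ⟩
      sum (λ j → x * (w j * sum (λ r → γ r * K r j) B)) B
        ≈⟨ sum-*ˡ _ _ B ⟩
      x * sum (λ j → w j * sum (λ r → γ r * K r j) B) B
        ≈⟨ *-congˡ (sum-cong B λ j _ → sum-*ˡ _ _ B) ⟨
      x * sum (λ j → sum (λ r → w j * (γ r * K r j)) B) B
        ≈⟨ *-congˡ (sum-swap _ B B) ⟩
      x * sum (λ r → sum (λ j → w j * (γ r * K r j)) B) B
        ≈⟨ *-congˡ (sum-cong B λ r r<B → begin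
             sum (λ j → w j * (γ r * K r j)) B   ≈⟨ sum-cong B (λ j _ → solve 3 (λ a b s → a :* (b :* s) := b :* (a :* s)) refl _ _ _) ⟩
             sum (λ j → γ r * (w j * K r j)) B   ≈⟨ sum-*ˡ _ _ B ⟩
             γ r * sum (λ j → w j * K r j) B     ≈⟨ *-congˡ (evaluate r r<B) ⟩
             γ r * E r                           ∎) ⟩
      x * sum (λ r → γ r * E r) B  ∎

    kernel : ℕ → ℕ → ℕ → Carrier
    kernel a r j = ipochDiff 3 r j * ipoch 3 (r ℕ.+ j ℕ.+ a)

    kernel-vanish : ∀ a {r j} → r < j → kernel a r j ≈ 0#
    kernel-vanish a r<j = trans (*-congʳ (ipochDiff-< 3 r<j)) (zeroˡ _)

    module _ (n a : ℕ) where

      -- For r ≥ n > 0 the index `n ∸ suc r` truncates, but 3r + a > n then makes the last factor 0.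
      coefficient : ℕ → Carrier
      coefficient r = q^ (3 ℕ.* r ℕ.* r ℕ.+ 3 ℕ.* a ℕ.* r) * poch 3 (n ∸ suc r) * ipochDiff 1 n (3 ℕ.* r ℕ.+ a)

      -- [2n+a brack n-3j-a]_q, where j ≥ 0.
      qbinomial : ℕ → Carrier
      qbinomial j = poch 1 (2 ℕ.* n ℕ.+ a) * (ipochDiff 1 n (3 ℕ.* j ℕ.+ a) * ipoch 1 (n ℕ.+ 3 ℕ.* j ℕ.+ 2 ℕ.* a))

      coefficient-vanish : ∀ {r} → n < 3 ℕ.* r ℕ.+ a → coefficient r ≈ 0#
      coefficient-vanish n<3r+a = trans (*-congˡ (ipochDiff-< 1 n<3r+a)) (zeroʳ _)

      -- Substituting r = j + s, m = 2j + a and N = n - 3j - a gives the cubic sum: 2n + a = 2N +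
      -- 3m, and 3r² + 3ar splits into 3j² + 3aj plus 3s² + 3ms, so the part depending on j alone
      -- leaves the sum.
      qbinomial-expansion : ∀ B j → 1 ≤ n → n < B →
        (1# - q^ (2 ℕ.* n ℕ.+ a)) * sum (λ r → coefficient r * kernel a r j) B ≈
        q^ (3 ℕ.* j ℕ.* j ℕ.+ 3 ℕ.* a ℕ.* j) * qbinomial j
      qbinomial-expansion B j 1≤n n<B with n ℕ.<? 3 ℕ.* j ℕ.+ a
      ... | yes n<3j+a = begin
        (1# - q^ (2 ℕ.* n ℕ.+ a)) * sum (λ r → coefficient r * kernel a r j) B
          ≈⟨ *-congˡ (sum-0 B λ r _ → vanish r) ⟩
        (1# - q^ (2 ℕ.* n ℕ.+ a)) * 0#
          ≈⟨ solve 4 (λ x y z w → x :* 𝟘 := y :* (z :* (𝟘 :* w))) refl _ _ _ _ ⟩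
        q^ (3 ℕ.* j ℕ.* j ℕ.+ 3 ℕ.* a ℕ.* j) * (poch 1 (2 ℕ.* n ℕ.+ a) * (0# * ipoch 1 (n ℕ.+ 3 ℕ.* j ℕ.+ 2 ℕ.* a)))
          ≈⟨ *-congˡ (*-congˡ (*-congʳ (ipochDiff-< 1 n<3j+a))) ⟨
        q^ (3 ℕ.* j ℕ.* j ℕ.+ 3 ℕ.* a ℕ.* j) * qbinomial j  ∎
        where
        vanish : ∀ r → coefficient r * kernel a r j ≈ 0#
        -- Every summand has a zero factor: the kernel if r < j, and the coefficient if r ≥ j, since
        -- then 3r + a ≥ 3j + a > n.
        vanish r with r ℕ.<? j
        ... | yes r<j = trans (*-congˡ (kernel-vanish a r<j)) (zeroʳ _)
        ... | no r≮j  = trans (*-congʳ (coefficient-vanish (ℕₚ.<-≤-trans n<3j+a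
                          (ℕₚ.+-monoˡ-≤ a (ℕₚ.*-monoʳ-≤ 3 (ℕₚ.≮⇒≥ r≮j)))))) (zeroˡ _)
      ... | no n≮3j+a with ℕₚ.m≤n⇒∃[o]m+o≡n (ℕₚ.≮⇒≥ n≮3j+a)
                         | ℕₚ.m≤n⇒∃[o]m+o≡n (ℕₚ.≤-trans (ℕₚ.m≤n*m j 3) (ℕₚ.≤-trans (ℕₚ.m≤m+n (3 ℕ.* j) a) (ℕₚ.≤-trans (ℕₚ.≮⇒≥ n≮3j+a) (ℕₚ.<⇒≤ n<B))))
      ... | N , 3j+a+N≡n | B′ , ≡.refl = begin
        (1# - q^ (2 ℕ.* n ℕ.+ a)) * sum (λ r → coefficient r * kernel a r j) (j ℕ.+ B′)
          ≈⟨ *-congˡ (sum-split _ j B′) ⟩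
        (1# - q^ (2 ℕ.* n ℕ.+ a)) * (sum (λ r → coefficient r * kernel a r j) j + sum (λ s → coefficient (j ℕ.+ s) * kernel a (j ℕ.+ s) j) B′)
          ≈⟨ *-congˡ (+-cong (sum-0 j λ r r<j → trans (*-congˡ (kernel-vanish a r<j)) (zeroʳ _)) (trans (sum-cong B′ λ s _ → term s) (sum-*ˡ _ _ B′))) ⟩
        (1# - q^ (2 ℕ.* n ℕ.+ a)) * (0# + z * sum (cubicTerm m N) B′)
          ≈⟨ solve 3 (λ x z s → (𝟙 :- x) :* (𝟘 :+ z :* s) := z :* ((𝟙 :- x) :* s)) refl _ _ _ ⟩
        z * ((1# - q^ (2 ℕ.* n ℕ.+ a)) * sum (cubicTerm m N) B′)
          ≈⟨ *-congˡ (*-congʳ (1-‿cong (q^-≡ 2n+a))) ⟩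
        z * ((1# - q^ (2 ℕ.* N ℕ.+ 3 ℕ.* m)) * sum (cubicTerm m N) B′)
          ≈⟨ *-congˡ (cubicSum m B′ N 1≤m+N N<3B′) ⟩
        z * (poch 1 (2 ℕ.* N ℕ.+ 3 ℕ.* m) * (ipoch 1 N * ipoch 1 (N ℕ.+ 3 ℕ.* m)))
          ≈⟨ *-congˡ (*-cong (reflexive (≡.cong (poch 1) 2n+a)) (*-cong (ipochDiff-≡ 1 (3 ℕ.* j ℕ.+ a) N (≡.sym 3j+a+N≡n)) (reflexive (≡.cong (ipoch 1) n+3j+2a)))) ⟨
        z * qbinomial j  ∎
        where
        m = 2 ℕ.* j ℕ.+ a
        z = q^ (3 ℕ.* j ℕ.* j ℕ.+ 3 ℕ.* a ℕ.* j)

        n≡ : n ≡ j ℕ.+ (m ℕ.+ N)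
        n≡ = ≡.trans (≡.sym 3j+a+N≡n) (lemma j a N)
          where
          lemma : ∀ j a N → 3 ℕ.* j ℕ.+ a ℕ.+ N ≡ j ℕ.+ (2 ℕ.* j ℕ.+ a ℕ.+ N)
          lemma = ℕRing.solve-∀

        2n+a : 2 ℕ.* n ℕ.+ a ≡ 2 ℕ.* N ℕ.+ 3 ℕ.* m
        2n+a = ≡.trans (≡.cong (λ k → 2 ℕ.* k ℕ.+ a) n≡) (lemma j a N)
          where
          lemma : ∀ j a N → 2 ℕ.* (j ℕ.+ (2 ℕ.* j ℕ.+ a ℕ.+ N)) ℕ.+ a ≡ 2 ℕ.* N ℕ.+ 3 ℕ.* (2 ℕ.* j ℕ.+ a)
          lemma = ℕRing.solve-∀

        n+3j+2a : n ℕ.+ 3 ℕ.* j ℕ.+ 2 ℕ.* a ≡ N ℕ.+ 3 ℕ.* m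
        n+3j+2a = ≡.trans (≡.cong (λ k → k ℕ.+ 3 ℕ.* j ℕ.+ 2 ℕ.* a) n≡) (lemma j a N)
          where
          lemma : ∀ j a N → j ℕ.+ (2 ℕ.* j ℕ.+ a ℕ.+ N) ℕ.+ 3 ℕ.* j ℕ.+ 2 ℕ.* a ≡ N ℕ.+ 3 ℕ.* (2 ℕ.* j ℕ.+ a)
          lemma = ℕRing.solve-∀

        -- If m + N were 0, then 2j = 0, so n = j + (m + N) would be 0. This is where n > 0 enters.
        1≤m+N : 1 ≤ m ℕ.+ N
        1≤m+N = ℕₚ.n≢0⇒n>0 λ m+N≡0 → ℕₚ.<⇒≢ 1≤n (≡.sym (≡.trans n≡ (≡.cong₂ ℕ._+_
          (ℕₚ.m+n≡0⇒m≡0 j (ℕₚ.m+n≡0⇒m≡0 (2 ℕ.* j) (ℕₚ.m+n≡0⇒m≡0 m m+N≡0))) m+N≡0)))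

        N<3B′ : N < 3 ℕ.* B′
        N<3B′ = ℕₚ.<-≤-trans (ℕₚ.≤-<-trans (ℕₚ.m≤n+m N m)
          (ℕₚ.+-cancelˡ-< j (m ℕ.+ N) B′ (≡.subst (_< j ℕ.+ B′) n≡ n<B))) (ℕₚ.m≤n*m B′ 3)

        term : ∀ s → coefficient (j ℕ.+ s) * kernel a (j ℕ.+ s) j ≈ z * cubicTerm m N s
        term s = begin
          coefficient (j ℕ.+ s) * kernel a (j ℕ.+ s) j
            ≈⟨ *-cong (*-cong (*-cong (trans (q^-≡ (exponent j s a)) (q^-+ _ _))
                                      (reflexive (≡.cong (poch 3) (≡.trans (≡.cong₂ _∸_ n≡ (≡.sym (ℕₚ.+-suc j s))) (ℕₚ.[m+n]∸[m+o]≡n∸o j (m ℕ.+ N) (suc s))))))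
                              (reflexive (≡.trans (≡.cong₂ (ipochDiff 1) (≡.sym 3j+a+N≡n) (shift j s a)) (ipochDiff-+ 1 (3 ℕ.* j ℕ.+ a) N (3 ℕ.* s)))))
                      (*-cong (reflexive (ipochDiff-m+n-m 3 j s)) (reflexive (≡.cong (ipoch 3) (index j s a)))) ⟩
          z * y * p * d * (u * v)
            ≈⟨ solve 6 (λ z y p d u v → z :* y :* p :* d :* (u :* v) := z :* (y :* p :* d :* (u :* v))) refl _ _ _ _ _ _ ⟩
          z * cubicTerm m N s  ∎
          where
          y = q^ (3 ℕ.* s ℕ.* s ℕ.+ 3 ℕ.* m ℕ.* s)
          p = poch 3 (m ℕ.+ N ∸ suc s)
          d = ipochDiff 1 N (3 ℕ.* s)
          u = ipoch 3 s
          v = ipoch 3 (s ℕ.+ m)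
          exponent : ∀ j s a → 3 ℕ.* (j ℕ.+ s) ℕ.* (j ℕ.+ s) ℕ.+ 3 ℕ.* a ℕ.* (j ℕ.+ s) ≡
                     3 ℕ.* j ℕ.* j ℕ.+ 3 ℕ.* a ℕ.* j ℕ.+ (3 ℕ.* s ℕ.* s ℕ.+ 3 ℕ.* (2 ℕ.* j ℕ.+ a) ℕ.* s)
          exponent = ℕRing.solve-∀
          shift : ∀ j s a → 3 ℕ.* (j ℕ.+ s) ℕ.+ a ≡ 3 ℕ.* j ℕ.+ a ℕ.+ 3 ℕ.* s
          shift = ℕRing.solve-∀
          index : ∀ j s a → j ℕ.+ s ℕ.+ j ℕ.+ a ≡ s ℕ.+ (2 ℕ.* j ℕ.+ a)
          index = ℕRing.solve-∀

    -- The folded identities for the two values of a.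

    q^3*-+ : ∀ k l → q^ (3 ℕ.* (k ℕ.+ l)) ≈ q^ (3 ℕ.* k) * q^ (3 ℕ.* l)
    q^3*-+ k l = trans (q^-≡ (ℕₚ.*-distribˡ-+ 3 k l)) (q^-+ _ _)

    -- Over the common denominator (Q;Q)_{r-j} (Q;Q)_{r+j+1} the numerator is (1 - Q^{r+j+1}) - (1 -
    -- Q^{r-j}) = Q^{r-j} (1 - Q^{2j+1}). The weight Q^{j²+j} turns Q^{r-j} into Q^r Q^{j²}, so the
    -- case a = 0 uses the same alternating sum as a = 1.
    kernel-difference : ∀ r j →
      sgn j * q^ (3 ℕ.* (j ℕ.* j ℕ.+ j)) * (kernel 0 r j - kernel 0 r (suc j)) ≈
      q^ (3 ℕ.* r) * altTerm 2 r j
    kernel-difference r j with j ℕ.≤? r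
    ... | no j≰r = begin
      g * q^ (3 ℕ.* (j ℕ.* j ℕ.+ j)) * (kernel 0 r j - kernel 0 r (suc j))
        ≈⟨ *-congˡ (+-cong (kernel-vanish 0 r<j) (-‿cong (kernel-vanish 0 (ℕₚ.m<n⇒m<1+n r<j)))) ⟩
      g * q^ (3 ℕ.* (j ℕ.* j ℕ.+ j)) * (0# - 0#)
        ≈⟨ solve 3 (λ x y z → x :* y :* (𝟘 :- 𝟘) := z :* 𝟘) refl _ _ _ ⟩
      q^ (3 ℕ.* r) * 0#
        ≈⟨ *-congˡ (altTerm-vanish 2 r<j) ⟨
      q^ (3 ℕ.* r) * altTerm 2 r j  ∎
      where
      r<j = ℕₚ.≰⇒> j≰r
      g = sgn j
    ... | yes j≤r with ℕₚ.m≤n⇒∃[o]m+o≡n j≤r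
    ... | e , ≡.refl = begin
      g * q^ (3 ℕ.* (j ℕ.* j ℕ.+ j)) * (kernel 0 r j - kernel 0 r (suc j))
        ≈⟨ *-cong (*-congˡ (q^3*-+ (j ℕ.* j) j))
                  (+-cong (*-cong (ipochDiff-≡ 3 j e ≡.refl) v↓) (-‿cong (*-cong (ipochDiff-suc e) v≡))) ⟩
      g * (b * J) * (u * ((1# - Q * (J * E * J)) * v) - (1# - E) * u * v)
        ≈⟨ solve 7 (λ g b J E Q u v → g :* (b :* J) :* (u :* ((𝟙 :- Q :* (J :* E :* J)) :* v) :- (𝟙 :- E) :* u :* v)
                    := J :* E :* (g :* b :* (𝟙 :- Q :* (J :* J)) :* (u :* v))) refl g b J E Q u v ⟩
      J * E * (g * b * (1# - Q * (J * J)) * (u * v))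
        ≈⟨ *-cong (q^3*-+ j e) (*-cong (*-congˡ (1-‿cong (trans (q^3*-+ 1 (j ℕ.+ j)) (*-congˡ (q^3*-+ j j)))))
                                       (*-congʳ (ipochDiff-≡ 3 j e ≡.refl))) ⟨
      q^ (3 ℕ.* r) * altTerm 2 r j  ∎
      where
      g = sgn j
      b = q^ (3 ℕ.* (j ℕ.* j))
      J = q^ (3 ℕ.* j)
      E = q^ (3 ℕ.* e)
      Q = q^ (3 ℕ.* 1)
      u = ipoch 3 e
      v = ipoch 3 (suc (r ℕ.+ j))
      v≡ : ipoch 3 (r ℕ.+ suc j ℕ.+ 0) ≈ v
      v≡ = reflexive (≡.cong (ipoch 3) (≡.trans (ℕₚ.+-identityʳ _) (ℕₚ.+-suc r j)))
      v↓ : ipoch 3 (r ℕ.+ j ℕ.+ 0) ≈ (1# - Q * (J * E * J)) * v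
      v↓ = begin
        ipoch 3 (r ℕ.+ j ℕ.+ 0)                        ≈⟨ reflexive (≡.cong (ipoch 3) (ℕₚ.+-identityʳ (r ℕ.+ j))) ⟩
        ipoch 3 (r ℕ.+ j)                              ≈⟨ ipoch-pred 2 (r ℕ.+ j) ⟨
        (1# - q^ (3 ℕ.* suc (r ℕ.+ j))) * v            ≈⟨ *-congʳ (1-‿cong (trans (q^3*-+ 1 (r ℕ.+ j)) (*-congˡ (trans (q^3*-+ r j) (*-congʳ (q^3*-+ j e)))))) ⟩
        (1# - Q * (J * E * J)) * v                     ∎
      -- The case e = 0 is needed for r = j, where the convention for `ipochDiff` agrees with the
      -- factor 1 - q^0 = 0.
      ipochDiff-suc : ∀ e → ipochDiff 3 (j ℕ.+ e) (suc j) ≈ (1# - q^ (3 ℕ.* e)) * ipoch 3 e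
      ipochDiff-suc zero = begin
        ipochDiff 3 (j ℕ.+ 0) (suc j)     ≈⟨ ipochDiff-< 3 (s≤s (ℕₚ.≤-reflexive (ℕₚ.+-identityʳ j))) ⟩
        0#                                ≈⟨ zeroˡ _ ⟨
        0# * 1#                           ≈⟨ *-congʳ 1-q^0 ⟨
        (1# - q^ 0) * 1#                  ∎
      ipochDiff-suc (suc e) = trans (ipochDiff-≡ 3 (suc j) e (ℕₚ.+-suc j e)) (sym (ipoch-pred 2 e))

    -- Both halves of a pair contain the same q-binomial, and their exponents differ by 3(2j+1). The
    -- pair is therefore the weight of `altTerm 2` times one expanded q-binomial.
    foldedIdentity₁ : ∀ n B → 1 ≤ n → n < B →
      sum (λ j → sgn j * (q^ (6 ℕ.* j ℕ.* j ℕ.+ 3 ℕ.* j) * qbinomial n 1 j) -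
                 sgn j * (q^ (6 ℕ.* j ℕ.* j ℕ.+ 9 ℕ.* j ℕ.+ 3) * qbinomial n 1 j)) B ≈
      (1# - q^ (2 ℕ.* n ℕ.+ 1)) * sum (λ r → coefficient n 1 r * ipoch 6 r) B
    foldedIdentity₁ n B 1≤n n<B = trans
      (sum-cong B λ j _ → pair j)
      (sum-exchange _ (coefficient n 1) w (λ j → z j * qbinomial n 1 j) (ipoch 6) (kernel 1) B
        (λ j → qbinomial-expansion n 1 B j 1≤n n<B)
        (λ r r<B → trans (sum-cong B λ j _ → *-congˡ (*-congˡ (reflexive (≡.cong (ipoch 3) (ℕₚ.+-comm (r ℕ.+ j) 1)))))
                         (sum-altTerm 2 r B r<B)))
      where
      z w : ℕ → Carrier
      z j = q^ (3 ℕ.* j ℕ.* j ℕ.+ 3 ℕ.* 1 ℕ.* j)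
      w j = sgn j * q^ (3 ℕ.* (j ℕ.* j)) * (1# - q^ (3 ℕ.* suc (j ℕ.+ j)))
      pair : ∀ j → sgn j * (q^ (6 ℕ.* j ℕ.* j ℕ.+ 3 ℕ.* j) * qbinomial n 1 j) -
                   sgn j * (q^ (6 ℕ.* j ℕ.* j ℕ.+ 9 ℕ.* j ℕ.+ 3) * qbinomial n 1 j) ≈
                   w j * (z j * qbinomial n 1 j)
      pair j = trans
        (+-cong (*-congˡ (*-congʳ (trans (q^-≡ (lemma₁ j)) (q^-+ _ _))))
                (-‿cong (*-congˡ (*-congʳ (trans (q^-≡ (lemma₂ j)) (trans (q^-+ _ _) (*-congʳ (q^-+ _ _))))))))
        (solve 5 (λ g b c z X → g :* (b :* z :* X) :- g :* (b :* c :* z :* X) := g :* b :* (𝟙 :- c) :* (z :* X)) refl _ _ _ _ _)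
        where
        lemma₁ : ∀ j → 6 ℕ.* j ℕ.* j ℕ.+ 3 ℕ.* j ≡ 3 ℕ.* (j ℕ.* j) ℕ.+ (3 ℕ.* j ℕ.* j ℕ.+ 3 ℕ.* 1 ℕ.* j)
        lemma₁ = ℕRing.solve-∀
        lemma₂ : ∀ j → 6 ℕ.* j ℕ.* j ℕ.+ 9 ℕ.* j ℕ.+ 3 ≡
                 3 ℕ.* (j ℕ.* j) ℕ.+ 3 ℕ.* suc (j ℕ.+ j) ℕ.+ (3 ℕ.* j ℕ.* j ℕ.+ 3 ℕ.* 1 ℕ.* j)
        lemma₂ = ℕRing.solve-∀

    -- Here 6j² + 3j = 3(j²+j) + 3j² and 6j² + 9j + 3 = 3(j²+j) + 3(j+1)². The pair thus has the
    -- common weight Q^{j²+j}, and what it multiplies is a difference of two consecutive expansions,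
    -- so the exchange runs with the differenced kernel.
    foldedIdentity₀ : ∀ n B → 1 ≤ n → n < B →
      sum (λ j → sgn j * (q^ (6 ℕ.* j ℕ.* j ℕ.+ 3 ℕ.* j) * qbinomial n 0 j) -
                 sgn j * (q^ (6 ℕ.* j ℕ.* j ℕ.+ 9 ℕ.* j ℕ.+ 3) * qbinomial n 0 (suc j))) B ≈
      (1# - q^ (2 ℕ.* n ℕ.+ 0)) * sum (λ r → coefficient n 0 r * (q^ (3 ℕ.* r) * ipoch 6 r)) B
    foldedIdentity₀ n B 1≤n n<B = trans
      (sum-cong B λ j _ → pair j)
      (sum-exchange _ (coefficient n 0) w (λ j → Z j - Z (suc j)) (λ r → q^ (3 ℕ.* r) * ipoch 6 r)
        (λ r j → kernel 0 r j - kernel 0 r (suc j)) B expand evaluate)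
      where
      z w Z : ℕ → Carrier
      z j = q^ (3 ℕ.* j ℕ.* j ℕ.+ 3 ℕ.* 0 ℕ.* j)
      w j = sgn j * q^ (3 ℕ.* (j ℕ.* j ℕ.+ j))
      Z j = z j * qbinomial n 0 j

      pair : ∀ j → sgn j * (q^ (6 ℕ.* j ℕ.* j ℕ.+ 3 ℕ.* j) * qbinomial n 0 j) -
                   sgn j * (q^ (6 ℕ.* j ℕ.* j ℕ.+ 9 ℕ.* j ℕ.+ 3) * qbinomial n 0 (suc j)) ≈
                   w j * (Z j - Z (suc j))
      pair j = trans
        (+-cong (*-congˡ (*-congʳ (trans (q^-≡ (lemma₁ j)) (q^-+ _ _))))
                (-‿cong (*-congˡ (*-congʳ (trans (q^-≡ (lemma₂ j)) (q^-+ _ _))))))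
        (solve 6 (λ g b z z′ X X′ → g :* (b :* z :* X) :- g :* (b :* z′ :* X′) := g :* b :* (z :* X :- z′ :* X′)) refl _ _ _ _ _ _)
        where
        lemma₁ : ∀ j → 6 ℕ.* j ℕ.* j ℕ.+ 3 ℕ.* j ≡ 3 ℕ.* (j ℕ.* j ℕ.+ j) ℕ.+ (3 ℕ.* j ℕ.* j ℕ.+ 3 ℕ.* 0 ℕ.* j)
        lemma₁ = ℕRing.solve-∀
        lemma₂ : ∀ j → 6 ℕ.* j ℕ.* j ℕ.+ 9 ℕ.* j ℕ.+ 3 ≡
                 3 ℕ.* (j ℕ.* j ℕ.+ j) ℕ.+ (3 ℕ.* suc j ℕ.* suc j ℕ.+ 3 ℕ.* 0 ℕ.* suc j)
        lemma₂ = ℕRing.solve-∀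

      expand : ∀ j → (1# - q^ (2 ℕ.* n ℕ.+ 0)) * sum (λ r → coefficient n 0 r * (kernel 0 r j - kernel 0 r (suc j))) B ≈
                     Z j - Z (suc j)
      expand j = begin
        x * sum (λ r → coefficient n 0 r * (kernel 0 r j - kernel 0 r (suc j))) B
          ≈⟨ *-congˡ (sum-cong B λ r _ → solve 3 (λ a b c → a :* (b :- c) := a :* b :+ (:- 𝟙) :* (a :* c)) refl _ _ _) ⟩
        x * sum (λ r → coefficient n 0 r * kernel 0 r j + - 1# * (coefficient n 0 r * kernel 0 r (suc j))) B
          ≈⟨ *-congˡ (trans (sum-+ _ _ B) (+-congˡ (sum-*ˡ _ _ B))) ⟩
        x * (S j + - 1# * S (suc j))
          ≈⟨ solve 3 (λ x s t → x :* (s :+ (:- 𝟙) :* t) := x :* s :- x :* t) refl _ _ _ ⟩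
        x * S j - x * S (suc j)
          ≈⟨ +-cong (qbinomial-expansion n 0 B j 1≤n n<B) (-‿cong (qbinomial-expansion n 0 B (suc j) 1≤n n<B)) ⟩
        Z j - Z (suc j)  ∎
        where
        x = 1# - q^ (2 ℕ.* n ℕ.+ 0)
        S : ℕ → Carrier
        S j = sum (λ r → coefficient n 0 r * kernel 0 r j) B

      evaluate : ∀ r → r < B → sum (λ j → w j * (kernel 0 r j - kernel 0 r (suc j))) B ≈ q^ (3 ℕ.* r) * ipoch 6 r
      evaluate r r<B = begin
        sum (λ j → w j * (kernel 0 r j - kernel 0 r (suc j))) B     ≈⟨ sum-cong B (λ j _ → kernel-difference r j) ⟩
        sum (λ j → q^ (3 ℕ.* r) * altTerm 2 r j) B                      ≈⟨ sum-*ˡ _ _ B ⟩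
        q^ (3 ℕ.* r) * sum (altTerm 2 r) B                              ≈⟨ *-congˡ (sum-altTerm 2 r B r<B) ⟩
        q^ (3 ℕ.* r) * ipoch 6 r                                        ∎

    -- q-binomials at integer arguments, and the two-sided sum.

    qbin : ℤ → ℤ → Carrier
    qbin (+ m) (+ n) = poch 1 (m ℕ.+ n) * ipoch 1 m * ipoch 1 n
    qbin _     _     = 0#

    qbin-comm : ∀ i j → qbin i j ≈ qbin j i
    qbin-comm (+ m)    (+ n)    = trans
      (*-congʳ (*-congʳ (reflexive (≡.cong (poch 1) (ℕₚ.+-comm m n)))))
      (solve 3 (λ p u v → p :* u :* v := p :* v :* u) refl _ _ _)
    qbin-comm (+ m)    -[1+ n ] = refl
    qbin-comm -[1+ m ] (+ n)    = refl
    qbin-comm -[1+ m ] -[1+ n ] = refl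

    -- The hypothesis says that k + (x - y) = t without integer subtraction. The recursion of
    -- `ipochDiff` in both arguments follows that of `⊖`, and a negative difference gives 0 on both
    -- sides.
    qbin-⊖ : ∀ k x y t → k ℕ.+ x ≡ t ℕ.+ y →
      qbin (+ k) (x ℤ.⊖ y) ≈ poch 1 t * (ipochDiff 1 x y * ipoch 1 k)
    qbin-⊖ k x zero t eq = begin
      poch 1 (k ℕ.+ x) * ipoch 1 k * ipoch 1 x     ≈⟨ *-congʳ (*-congʳ (reflexive (≡.cong (poch 1) (≡.trans eq (ℕₚ.+-identityʳ t))))) ⟩
      poch 1 t * ipoch 1 k * ipoch 1 x                ≈⟨ solve 3 (λ p u v → p :* u :* v := p :* (v :* u)) refl _ _ _ ⟩
      poch 1 t * (ipoch 1 x * ipoch 1 k)              ∎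
    qbin-⊖ k zero (suc y) t eq = sym (trans (*-congˡ (zeroˡ _)) (zeroʳ _))
    qbin-⊖ k (suc x) (suc y) t eq = trans
      (reflexive (≡.cong (qbin (+ k)) (ℤₚ.[1+m]⊖[1+n]≡m⊖n x y)))
      (qbin-⊖ k x y t (ℕₚ.suc-injective (≡.trans (≡.sym (ℕₚ.+-suc k x)) (≡.trans eq (ℕₚ.+-suc t y)))))

    qbinAt : ℕ → ℕ → ℤ → Carrier
    qbinAt n a j = qbin (+ n ℤ.+ + 3 ℤ.* j ℤ.+ + (2 ℕ.* a)) (+ n ℤ.- + 3 ℤ.* j ℤ.- + a)

    qbinAt-pos : ∀ n a j → qbinAt n a (+ j) ≈ qbinomial n a j
    qbinAt-pos n a j = trans
      (reflexive (≡.cong₂ qbin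
        (≡.cong (λ x → + n ℤ.+ x ℤ.+ + (2 ℕ.* a)) (≡.sym (ℤₚ.pos-* 3 j)))
        (≡.trans (≡.cong (λ x → + n ℤ.- x ℤ.- + a) (≡.sym (ℤₚ.pos-* 3 j)))
                 (≡.trans (difference (+ n) (+ (3 ℕ.* j)) (+ a)) (ℤₚ.m-n≡m⊖n n (3 ℕ.* j ℕ.+ a))))))
      (qbin-⊖ (n ℕ.+ 3 ℕ.* j ℕ.+ 2 ℕ.* a) n (3 ℕ.* j ℕ.+ a) (2 ℕ.* n ℕ.+ a) (total n a j))
      where
      difference : ∀ x y z → x ℤ.- y ℤ.- z ≡ x ℤ.- (y ℤ.+ z)
      difference = ℤRing.solve-∀
      total : ∀ n a j → n ℕ.+ 3 ℕ.* j ℕ.+ 2 ℕ.* a ℕ.+ n ≡ 2 ℕ.* n ℕ.+ a ℕ.+ (3 ℕ.* j ℕ.+ a)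
      total = ℕRing.solve-∀

    -- After `qbin-comm` the second argument at index -1-j is n - 3(j+1) + 2a, which is n - 3j′ - a
    -- for j′ = j + 1 - a.
    qbinAt-neg : ∀ n a j j′ → j′ ℕ.+ a ≡ suc j →
      qbinAt n a -[1+ j ] ≈ qbinomial n a j′
    qbinAt-neg n a j j′ eq = trans (qbin-comm _ (+ n ℤ.- + 3 ℤ.* -[1+ j ] ℤ.- + a)) (trans
      (reflexive (≡.cong₂ qbin (≡.trans (≡.cong (λ x → + n ℤ.- x ℤ.- + a) 3*-[1+j]) (first (+ n) (+ (3 ℕ.* j′)) (+ a) (+ (2 ℕ.* a))))
        (≡.trans (≡.cong (λ x → + n ℤ.+ x ℤ.+ + (2 ℕ.* a)) 3*-[1+j])
                 (≡.trans (second (+ n) (+ (3 ℕ.* j′)) (+ a) (+ (2 ℕ.* a))) (ℤₚ.m-n≡m⊖n n (3 ℕ.* j′ ℕ.+ a))))))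
      (qbin-⊖ (n ℕ.+ 3 ℕ.* j′ ℕ.+ 2 ℕ.* a) n (3 ℕ.* j′ ℕ.+ a) (2 ℕ.* n ℕ.+ a) (total n a j′)))
      where
      triple : ∀ j a → 3 ℕ.* (j ℕ.+ a) ≡ 3 ℕ.* j ℕ.+ a ℕ.+ 2 ℕ.* a
      triple = ℕRing.solve-∀
      3*-[1+j] : + 3 ℤ.* -[1+ j ] ≡ ℤ.- (+ (3 ℕ.* j′) ℤ.+ + a ℤ.+ + (2 ℕ.* a))
      3*-[1+j] = ≡.trans (≡.sym (ℤₚ.neg-distribʳ-* (+ 3) (+ suc j)))
        (≡.cong ℤ.-_ (≡.trans (≡.sym (ℤₚ.pos-* 3 (suc j)))
          (≡.cong +_ (≡.trans (≡.cong (3 ℕ.*_) (≡.sym eq)) (triple j′ a)))))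
      first : ∀ x y z w → x ℤ.- ℤ.- (y ℤ.+ z ℤ.+ w) ℤ.- z ≡ x ℤ.+ y ℤ.+ w
      first = ℤRing.solve-∀
      second : ∀ x y z w → x ℤ.+ ℤ.- (y ℤ.+ z ℤ.+ w) ℤ.+ w ≡ x ℤ.- (y ℤ.+ z)
      second = ℤRing.solve-∀
      total : ∀ n a j → n ℕ.+ 3 ℕ.* j ℕ.+ 2 ℕ.* a ℕ.+ n ≡ 2 ℕ.* n ℕ.+ a ℕ.+ (3 ℕ.* j ℕ.+ a)
      total = ℕRing.solve-∀

    exponent-pos : ∀ j → ∣ + 6 ℤ.* + j ℤ.* + j ℤ.+ + 3 ℤ.* + j ∣ ≡ 6 ℕ.* j ℕ.* j ℕ.+ 3 ℕ.* j
    exponent-pos j = ≡.cong ∣_∣ (≡.sym (≡.cong₂ ℤ._+_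
      (≡.trans (ℤₚ.pos-* (6 ℕ.* j) j) (≡.cong (ℤ._* + j) (ℤₚ.pos-* 6 j))) (ℤₚ.pos-* 3 j)))

    exponent-neg : ∀ j → ∣ + 6 ℤ.* -[1+ j ] ℤ.* -[1+ j ] ℤ.+ + 3 ℤ.* -[1+ j ] ∣ ≡ 6 ℕ.* j ℕ.* j ℕ.+ 9 ℕ.* j ℕ.+ 3
    exponent-neg j = ≡.cong ∣_∣ (≡.trans (lemma (+ j)) (≡.cong (ℤ._+ + 3) (≡.sym (≡.cong₂ ℤ._+_
      (≡.trans (ℤₚ.pos-* (6 ℕ.* j) j) (≡.cong (ℤ._* + j) (ℤₚ.pos-* 6 j))) (ℤₚ.pos-* 9 j)))))
      where
      lemma : ∀ y → + 6 ℤ.* (ℤ.- (+ 1 ℤ.+ y)) ℤ.* (ℤ.- (+ 1 ℤ.+ y)) ℤ.+ + 3 ℤ.* (ℤ.- (+ 1 ℤ.+ y)) ≡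
                     + 6 ℤ.* y ℤ.* y ℤ.+ + 9 ℤ.* y ℤ.+ + 3
      lemma = ℤRing.solve-∀

    rightTerm : ℕ → ℕ → ℤ → Carrier
    rightTerm n a j = sgn ∣ j ∣ * (q^ ∣ + 6 ℤ.* j ℤ.* j ℤ.+ + 3 ℤ.* j ∣ * qbinAt n a j)

    rightTerm-pos : ∀ n a j →
      rightTerm n a (+ j) ≈ sgn j * (q^ (6 ℕ.* j ℕ.* j ℕ.+ 3 ℕ.* j) * qbinomial n a j)
    rightTerm-pos n a j = *-congˡ (*-cong (q^-≡ (exponent-pos j)) (qbinAt-pos n a j))

    rightTerm-neg : ∀ n a j j′ → j′ ℕ.+ a ≡ suc j →
      rightTerm n a -[1+ j ] ≈ - (sgn j * (q^ (6 ℕ.* j ℕ.* j ℕ.+ 9 ℕ.* j ℕ.+ 3) * qbinomial n a j′))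
    rightTerm-neg n a j j′ eq = trans
      (*-congˡ (*-cong (q^-≡ (exponent-neg j)) (qbinAt-neg n a j j′ eq)))
      (solve 2 (λ x y → (:- x) :* y := :- (x :* y)) refl _ _)

    -- `σ` sends j to j + 1 - a, the index whose q-binomial equals the one at -1-j; it is the
    -- successor for a = 0 and the identity for a = 1. The bound on n annihilates the term at -1-N
    -- that folding adjoins.
    rightSide : ∀ n a N (σ : ℕ → ℕ) → (∀ j → σ j ℕ.+ a ≡ suc j) → n < 3 ℕ.* σ N ℕ.+ a →
      sumℤrange (rightTerm n a) N ≈
      sum (λ j → sgn j * (q^ (6 ℕ.* j ℕ.* j ℕ.+ 3 ℕ.* j) * qbinomial n a j) -
                 sgn j * (q^ (6 ℕ.* j ℕ.* j ℕ.+ 9 ℕ.* j ℕ.+ 3) * qbinomial n a (σ j))) (suc N)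
    rightSide n a N σ σ-eq n<3σN+a = trans
      (sumℤrange-fold (rightTerm n a) N vanish)
      (sum-cong (suc N) λ j _ → +-cong (rightTerm-pos n a j) (rightTerm-neg n a j (σ j) (σ-eq j)))
      where
      vanish : rightTerm n a -[1+ N ] ≈ 0#
      vanish = begin
        rightTerm n a -[1+ N ]                               ≈⟨ rightTerm-neg n a N (σ N) (σ-eq N) ⟩
        - (sgn N * (_ * qbinomial n a (σ N)))   ≈⟨ -‿cong (*-congˡ (*-congˡ (*-congˡ (*-congʳ (ipochDiff-< 1 n<3σN+a))))) ⟩
        - (sgn N * (_ * (_ * (0# * _))))        ≈⟨ solve 4 (λ g z p u → :- (g :* (z :* (p :* (𝟘 :* u)))) := 𝟘) refl _ _ _ _ ⟩
        0#                                                   ∎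

    -- The left-hand side, and the identity in an abstract ring.

    leftTerm : ℕ → ℕ → ℕ → Carrier
    leftTerm n a j = if (3 ℕ.* j ℕ.+ a) ≤ᵇ n
      then poch 3 (n ∸ j ∸ 1) * (1# - q^ (2 ℕ.* n ℕ.+ a)) * q^ (3 ℕ.* j ℕ.* j ℕ.+ 3 ℕ.* j)
           * ipoch 1 (n ∸ 3 ℕ.* j ∸ a) * ipoch 6 j
      else 0#

    -- `E` absorbs the gap between the exponents 3j² + 3j and 3j² + 3aj: it is 1 / (q⁶;q⁶)_j for a =
    -- 1 and carries an extra q^{3j} for a = 0. The Boolean guard matches the zero convention of
    -- `ipochDiff`.
    leftTerm-coefficient : ∀ n a j E →
      q^ (3 ℕ.* j ℕ.* j ℕ.+ 3 ℕ.* j) * ipoch 6 j ≈ q^ (3 ℕ.* j ℕ.* j ℕ.+ 3 ℕ.* a ℕ.* j) * E →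
      leftTerm n a j ≈ (1# - q^ (2 ℕ.* n ℕ.+ a)) * (coefficient n a j * E)
    leftTerm-coefficient n a j E eq with (3 ℕ.* j ℕ.+ a) ≤ᵇ n | ℕₚ.≤ᵇ-reflects-≤ (3 ℕ.* j ℕ.+ a) n
    ... | false | ofⁿ 3j+a≰n = sym (trans
      (*-congˡ (*-congʳ (coefficient-vanish n a (ℕₚ.≰⇒> 3j+a≰n))))
      (solve 2 (λ x y → x :* (𝟘 :* y) := 𝟘) refl _ _))
    ... | true | ofʸ 3j+a≤n = begin
      poch 3 (n ∸ j ∸ 1) * x * y * ipoch 1 (n ∸ 3 ℕ.* j ∸ a) * ipoch 6 j
        ≈⟨ *-congʳ (*-cong (*-congʳ (*-congʳ (reflexive (≡.cong (poch 3) n∸j∸1)))) (sym D)) ⟩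
      p * x * y * d * ipoch 6 j
        ≈⟨ solve 5 (λ p x y d u → p :* x :* y :* d :* u := x :* (p :* d :* (y :* u))) refl _ _ _ _ _ ⟩
      x * (p * d * (y * ipoch 6 j))
        ≈⟨ *-congˡ (*-congˡ eq) ⟩
      x * (p * d * (z * E))
        ≈⟨ solve 5 (λ p x z d u → x :* (p :* d :* (z :* u)) := x :* (z :* p :* d :* u)) refl _ _ _ _ _ ⟩
      x * (coefficient n a j * E)  ∎
      where
      x = 1# - q^ (2 ℕ.* n ℕ.+ a)
      y = q^ (3 ℕ.* j ℕ.* j ℕ.+ 3 ℕ.* j)
      z = q^ (3 ℕ.* j ℕ.* j ℕ.+ 3 ℕ.* a ℕ.* j)
      p = poch 3 (n ∸ suc j)
      d = ipochDiff 1 n (3 ℕ.* j ℕ.+ a)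
      n∸j∸1 : n ∸ j ∸ 1 ≡ n ∸ suc j
      n∸j∸1 = ≡.trans (ℕₚ.∸-+-assoc n j 1) (≡.cong (n ∸_) (ℕₚ.+-comm j 1))
      D : d ≈ ipoch 1 (n ∸ 3 ℕ.* j ∸ a)
      D = trans (ipochDiff-≡ 1 (3 ℕ.* j ℕ.+ a) (n ∸ (3 ℕ.* j ℕ.+ a)) (≡.sym (ℕₚ.m+[n∸m]≡n 3j+a≤n)))
                (reflexive (≡.cong (ipoch 1) (≡.sym (ℕₚ.∸-+-assoc n (3 ℕ.* j) a))))

    -- The coefficients vanish beyond n, so the sum can be padded to the bound of the folded
    -- right-hand side.
    leftSide : ∀ n a N (E : ℕ → Carrier) → n ≤ N →
      (∀ j → q^ (3 ℕ.* j ℕ.* j ℕ.+ 3 ℕ.* j) * ipoch 6 j ≈ q^ (3 ℕ.* j ℕ.* j ℕ.+ 3 ℕ.* a ℕ.* j) * E j) →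
      sum (leftTerm n a) (suc n) ≈
      (1# - q^ (2 ℕ.* n ℕ.+ a)) * sum (λ j → coefficient n a j * E j) (suc N)
    leftSide n a N E n≤N eq with ℕₚ.m≤n⇒∃[o]m+o≡n n≤N
    ... | d , ≡.refl = begin
      sum (leftTerm n a) (suc n)
        ≈⟨ sum-cong (suc n) (λ j _ → leftTerm-coefficient n a j (E j) (eq j)) ⟩
      sum (λ j → x * f j) (suc n)
        ≈⟨ sum-*ˡ _ _ (suc n) ⟩
      x * sum f (suc n)
        ≈⟨ *-congˡ (trans (+-congˡ (sum-0 d λ i _ → vanish i)) (+-identityʳ _)) ⟨
      x * (sum f (suc n) + sum (λ i → f (suc n ℕ.+ i)) d)
        ≈⟨ *-congˡ (sum-split _ (suc n) d) ⟨
      x * sum f (suc n ℕ.+ d)  ∎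
      where
      x = 1# - q^ (2 ℕ.* n ℕ.+ a)
      f : ℕ → Carrier
      f j = coefficient n a j * E j
      vanish : ∀ i → f (suc n ℕ.+ i) ≈ 0#
      vanish i = trans
        (*-congʳ (coefficient-vanish n a {suc n ℕ.+ i}
          (ℕₚ.≤-trans (ℕₚ.m≤m+n (suc n) i) (ℕₚ.≤-trans (ℕₚ.m≤n*m (suc n ℕ.+ i) 3) (ℕₚ.m≤m+n (3 ℕ.* (suc n ℕ.+ i)) a)))))
        (zeroˡ _)

    finiteIdentity : ∀ n a N → 1 ≤ n → a ≤ 1 → n ≤ N →
      sum (leftTerm n a) (suc n) ≈ sumℤrange (rightTerm n a) N
    finiteIdentity n 0 N 1≤n _ n≤N = begin
      sum (leftTerm n 0) (suc n)
        ≈⟨ leftSide n 0 N _ n≤N split ⟩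
      (1# - q^ (2 ℕ.* n ℕ.+ 0)) * sum (λ r → coefficient n 0 r * (q^ (3 ℕ.* r) * ipoch 6 r)) (suc N)
        ≈⟨ foldedIdentity₀ n (suc N) 1≤n (s≤s n≤N) ⟨
      sum _ (suc N)
        ≈⟨ rightSide n 0 N suc (λ j → ℕₚ.+-identityʳ (suc j)) (ℕₚ.≤-trans (s≤s n≤N) (ℕₚ.≤-trans (ℕₚ.m≤n*m (suc N) 3) (ℕₚ.m≤m+n _ 0))) ⟨
      sumℤrange (rightTerm n 0) N  ∎
      where
      split : ∀ j → q^ (3 ℕ.* j ℕ.* j ℕ.+ 3 ℕ.* j) * ipoch 6 j ≈
                    q^ (3 ℕ.* j ℕ.* j ℕ.+ 3 ℕ.* 0 ℕ.* j) * (q^ (3 ℕ.* j) * ipoch 6 j)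
      split j = trans
        (*-congʳ (trans (q^-+ _ _) (*-congʳ (q^-≡ (≡.sym (ℕₚ.+-identityʳ _))))))
        (*-assoc _ _ _)
    finiteIdentity n 1 N 1≤n _ n≤N = begin
      sum (leftTerm n 1) (suc n)
        ≈⟨ leftSide n 1 N (ipoch 6) n≤N (λ _ → refl) ⟩
      (1# - q^ (2 ℕ.* n ℕ.+ 1)) * sum (λ r → coefficient n 1 r * ipoch 6 r) (suc N)
        ≈⟨ foldedIdentity₁ n (suc N) 1≤n (s≤s n≤N) ⟨
      sum _ (suc N)
        ≈⟨ rightSide n 1 N (λ j → j) (λ j → ℕₚ.+-comm j 1) (≡.subst (n <_) (ℕₚ.+-comm 1 (3 ℕ.* N)) (s≤s (ℕₚ.≤-trans n≤N (ℕₚ.m≤n*m N 3)))) ⟨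
      sumℤrange (rightTerm n 1) N  ∎
    finiteIdentity n (suc (suc a)) N _ (s≤s ()) _

open import Defs

-- The commutative ring of formal power series.

module PowerSeries where
  open ≡-Reasoning

  tail : PS → PS
  tail f k = f (suc k)

  -ₚ_ : PS → PS
  (-ₚ f) k = ℤ.- f k

  sumℤ-cong : ∀ {f g} n → (∀ i → i < n → f i ≡ g i) → sumℤ f n ≡ sumℤ g n
  sumℤ-cong zero    f≡g = ≡.refl
  sumℤ-cong (suc n) f≡g =
    ≡.cong₂ ℤ._+_ (sumℤ-cong n λ i i<n → f≡g i (ℕₚ.m<n⇒m<1+n i<n)) (f≡g n (ℕₚ.n<1+n n))

  sumℤ-head : ∀ f n → sumℤ f (suc n) ≡ f 0 ℤ.+ sumℤ (tail f) n
  sumℤ-head f zero    = ℤₚ.+-comm (+ 0) (f 0)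
  sumℤ-head f (suc n) = begin
    sumℤ f (suc n) ℤ.+ f (suc n)                  ≡⟨ ≡.cong (ℤ._+ f (suc n)) (sumℤ-head f n) ⟩
    (f 0 ℤ.+ sumℤ (tail f) n) ℤ.+ f (suc n)       ≡⟨ ℤₚ.+-assoc (f 0) _ _ ⟩
    f 0 ℤ.+ sumℤ (tail f) (suc n)                 ∎

  *ₚ-zero : ∀ f g → (f *ₚ g) 0 ≡ f 0 ℤ.* g 0
  *ₚ-zero f g = ℤₚ.+-identityˡ _

  -- Peeling off the constant term of the left factor lets the ring laws go by induction on the
  -- coefficient index, without reindexing double sums. Commutativity also needs the peeling at the
  -- other end, `*ₚ-sucʳ`.
  *ₚ-sucˡ : ∀ f g k → (f *ₚ g) (suc k) ≡ f 0 ℤ.* g (suc k) ℤ.+ (tail f *ₚ g) k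
  *ₚ-sucˡ f g k = sumℤ-head (λ i → f i ℤ.* g (suc k ∸ i)) (suc k)

  *ₚ-sucʳ : ∀ f g k → (f *ₚ g) (suc k) ≡ (f *ₚ tail g) k ℤ.+ f (suc k) ℤ.* g 0
  *ₚ-sucʳ f g k = ≡.cong₂ ℤ._+_
    (sumℤ-cong (suc k) λ i i≤k → ≡.cong (λ j → f i ℤ.* g j) (ℕₚ.+-∸-assoc 1 (ℕₚ.≤-pred i≤k)))
    (≡.cong (λ j → f (suc k) ℤ.* g j) (ℕₚ.n∸n≡0 k))

  *ₚ-cong : ∀ {f f′ g g′} → f ≗ f′ → g ≗ g′ → f *ₚ g ≗ f′ *ₚ g′
  *ₚ-cong f≗f′ g≗g′ k = sumℤ-cong (suc k) λ i _ → ≡.cong₂ ℤ._*_ (f≗f′ i) (g≗g′ (k ∸ i))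

  *ₚ-comm : ∀ f g → f *ₚ g ≗ g *ₚ f
  *ₚ-comm f g zero    = ≡.cong (λ x → + 0 ℤ.+ x) (ℤₚ.*-comm (f 0) (g 0))
  *ₚ-comm f g (suc k) = begin
    (f *ₚ g) (suc k)                              ≡⟨ *ₚ-sucˡ f g k ⟩
    f 0 ℤ.* g (suc k) ℤ.+ (tail f *ₚ g) k         ≡⟨ ≡.cong₂ ℤ._+_ (ℤₚ.*-comm (f 0) (g (suc k))) (*ₚ-comm (tail f) g k) ⟩
    g (suc k) ℤ.* f 0 ℤ.+ (g *ₚ tail f) k         ≡⟨ ℤₚ.+-comm _ ((g *ₚ tail f) k) ⟩
    (g *ₚ tail f) k ℤ.+ g (suc k) ℤ.* f 0         ≡⟨ *ₚ-sucʳ g f k ⟨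
    (g *ₚ f) (suc k)                              ∎

  *ₚ-distribʳ : ∀ h f g → (f +ₚ g) *ₚ h ≗ (f *ₚ h) +ₚ (g *ₚ h)
  *ₚ-distribʳ h f g zero    = lemma (f 0) (g 0) (h 0)
    where
    lemma : ∀ a b c → + 0 ℤ.+ (a ℤ.+ b) ℤ.* c ≡ (+ 0 ℤ.+ a ℤ.* c) ℤ.+ (+ 0 ℤ.+ b ℤ.* c)
    lemma = ℤRing.solve-∀
  *ₚ-distribʳ h f g (suc k) = begin
    ((f +ₚ g) *ₚ h) (suc k)
      ≡⟨ *ₚ-sucˡ (f +ₚ g) h k ⟩
    (f 0 ℤ.+ g 0) ℤ.* h (suc k) ℤ.+ ((tail f +ₚ tail g) *ₚ h) k
      ≡⟨ ≡.cong (λ x → (f 0 ℤ.+ g 0) ℤ.* h (suc k) ℤ.+ x) (*ₚ-distribʳ h (tail f) (tail g) k) ⟩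
    (f 0 ℤ.+ g 0) ℤ.* h (suc k) ℤ.+ ((tail f *ₚ h) k ℤ.+ (tail g *ₚ h) k)
      ≡⟨ lemma (f 0) (g 0) (h (suc k)) _ _ ⟩
    (f 0 ℤ.* h (suc k) ℤ.+ (tail f *ₚ h) k) ℤ.+ (g 0 ℤ.* h (suc k) ℤ.+ (tail g *ₚ h) k)
      ≡⟨ ≡.cong₂ ℤ._+_ (*ₚ-sucˡ f h k) (*ₚ-sucˡ g h k) ⟨
    ((f *ₚ h) +ₚ (g *ₚ h)) (suc k)  ∎
    where
    lemma : ∀ a b c x y → (a ℤ.+ b) ℤ.* c ℤ.+ (x ℤ.+ y) ≡ (a ℤ.* c ℤ.+ x) ℤ.+ (b ℤ.* c ℤ.+ y)
    lemma = ℤRing.solve-∀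

  ·ₚ-*ₚ : ∀ c f g → (c ·ₚ f) *ₚ g ≗ c ·ₚ (f *ₚ g)
  ·ₚ-*ₚ c f g zero    = lemma c (f 0) (g 0)
    where
    lemma : ∀ c a b → + 0 ℤ.+ (c ℤ.* a) ℤ.* b ≡ c ℤ.* (+ 0 ℤ.+ a ℤ.* b)
    lemma = ℤRing.solve-∀
  ·ₚ-*ₚ c f g (suc k) = begin
    ((c ·ₚ f) *ₚ g) (suc k)                                         ≡⟨ *ₚ-sucˡ (c ·ₚ f) g k ⟩
    (c ℤ.* f 0) ℤ.* g (suc k) ℤ.+ ((c ·ₚ tail f) *ₚ g) k            ≡⟨ ≡.cong₂ ℤ._+_ (ℤₚ.*-assoc c (f 0) _) (·ₚ-*ₚ c (tail f) g k) ⟩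
    c ℤ.* (f 0 ℤ.* g (suc k)) ℤ.+ c ℤ.* (tail f *ₚ g) k             ≡⟨ ℤₚ.*-distribˡ-+ c _ _ ⟨
    c ℤ.* (f 0 ℤ.* g (suc k) ℤ.+ (tail f *ₚ g) k)                   ≡⟨ ≡.cong (c ℤ.*_) (*ₚ-sucˡ f g k) ⟨
    (c ·ₚ (f *ₚ g)) (suc k)                                         ∎

  *ₚ-assoc : ∀ f g h → (f *ₚ g) *ₚ h ≗ f *ₚ (g *ₚ h)
  *ₚ-assoc f g h zero    = lemma (f 0) (g 0) (h 0)
    where
    lemma : ∀ a b c → + 0 ℤ.+ (+ 0 ℤ.+ a ℤ.* b) ℤ.* c ≡ + 0 ℤ.+ a ℤ.* (+ 0 ℤ.+ b ℤ.* c)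
    lemma = ℤRing.solve-∀
  *ₚ-assoc f g h (suc k) = begin
    ((f *ₚ g) *ₚ h) (suc k)
      ≡⟨ *ₚ-sucˡ (f *ₚ g) h k ⟩
    (f *ₚ g) 0 ℤ.* h (suc k) ℤ.+ (tail (f *ₚ g) *ₚ h) k
      -- Read for all indices, `*ₚ-sucˡ f g` describes the whole series `tail (f *ₚ g)`.
      ≡⟨ ≡.cong₂ (λ x y → x ℤ.* h (suc k) ℤ.+ y) (*ₚ-zero f g) (*ₚ-cong {g = h} (*ₚ-sucˡ f g) (λ _ → ≡.refl) k) ⟩
    (f 0 ℤ.* g 0) ℤ.* h (suc k) ℤ.+ (((f 0 ·ₚ tail g) +ₚ (tail f *ₚ g)) *ₚ h) k
      ≡⟨ ≡.cong (λ x → (f 0 ℤ.* g 0) ℤ.* h (suc k) ℤ.+ x) (*ₚ-distribʳ h (f 0 ·ₚ tail g) (tail f *ₚ g) k) ⟩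
    (f 0 ℤ.* g 0) ℤ.* h (suc k) ℤ.+ (((f 0 ·ₚ tail g) *ₚ h) k ℤ.+ ((tail f *ₚ g) *ₚ h) k)
      ≡⟨ ≡.cong₂ (λ x y → (f 0 ℤ.* g 0) ℤ.* h (suc k) ℤ.+ (x ℤ.+ y)) (·ₚ-*ₚ (f 0) (tail g) h k) (*ₚ-assoc (tail f) g h k) ⟩
    (f 0 ℤ.* g 0) ℤ.* h (suc k) ℤ.+ (f 0 ℤ.* (tail g *ₚ h) k ℤ.+ (tail f *ₚ (g *ₚ h)) k)
      ≡⟨ lemma (f 0) (g 0) (h (suc k)) _ _ ⟩
    f 0 ℤ.* (g 0 ℤ.* h (suc k) ℤ.+ (tail g *ₚ h) k) ℤ.+ (tail f *ₚ (g *ₚ h)) k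
      ≡⟨ ≡.cong (λ x → f 0 ℤ.* x ℤ.+ (tail f *ₚ (g *ₚ h)) k) (*ₚ-sucˡ g h k) ⟨
    f 0 ℤ.* (g *ₚ h) (suc k) ℤ.+ (tail f *ₚ (g *ₚ h)) k
      ≡⟨ *ₚ-sucˡ f (g *ₚ h) k ⟨
    (f *ₚ (g *ₚ h)) (suc k)  ∎
    where
    lemma : ∀ a b c x y → (a ℤ.* b) ℤ.* c ℤ.+ (a ℤ.* x ℤ.+ y) ≡ a ℤ.* (b ℤ.* c ℤ.+ x) ℤ.+ y
    lemma = ℤRing.solve-∀

  *ₚ-zeroˡ : ∀ {f} → f ≗ 0ₚ → ∀ g → f *ₚ g ≗ 0ₚ
  *ₚ-zeroˡ {f} f≗0 g zero    = ≡.cong (λ x → + 0 ℤ.+ x ℤ.* g 0) (f≗0 0)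
  *ₚ-zeroˡ {f} f≗0 g (suc k) = ≡.trans (*ₚ-sucˡ f g k)
    (≡.cong₂ (λ x y → x ℤ.* g (suc k) ℤ.+ y) (f≗0 0) (*ₚ-zeroˡ (λ i → f≗0 (suc i)) g k))

  *ₚ-identityˡ : ∀ f → 1ₚ *ₚ f ≗ f
  *ₚ-identityˡ f zero    = ≡.trans (*ₚ-zero 1ₚ f) (ℤₚ.*-identityˡ (f 0))
  *ₚ-identityˡ f (suc k) = begin
    (1ₚ *ₚ f) (suc k)                              ≡⟨ *ₚ-sucˡ 1ₚ f k ⟩
    + 1 ℤ.* f (suc k) ℤ.+ (tail 1ₚ *ₚ f) k         ≡⟨ ≡.cong₂ ℤ._+_ (ℤₚ.*-identityˡ (f (suc k))) (*ₚ-zeroˡ (λ _ → ≡.refl) f k) ⟩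
    f (suc k) ℤ.+ + 0                              ≡⟨ ℤₚ.+-identityʳ _ ⟩
    f (suc k)                                      ∎

  isCommutativeRing : IsCommutativeRing _≗_ _+ₚ_ _*ₚ_ -ₚ_ 0ₚ 1ₚ
  isCommutativeRing = record
    { isRing = record
      { +-isAbelianGroup = record
        { isGroup = record
          { isMonoid = record
            { isSemigroup = record
              { isMagma = record
                { isEquivalence = record
                  { refl  = λ _ → ≡.refl
                  ; sym   = λ f≗g k → ≡.sym (f≗g k)
                  ; trans = λ f≗g g≗h k → ≡.trans (f≗g k) (g≗h k)
                  }
                ; ∙-cong = λ f≗f′ g≗g′ k → ≡.cong₂ ℤ._+_ (f≗f′ k) (g≗g′ k)
                }
              ; assoc = λ f g h k → ℤₚ.+-assoc (f k) (g k) (h k)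
              }
            ; identity = (λ f k → ℤₚ.+-identityˡ (f k)) , (λ f k → ℤₚ.+-identityʳ (f k))
            }
          ; inverse = (λ f k → ℤₚ.+-inverseˡ (f k)) , (λ f k → ℤₚ.+-inverseʳ (f k))
          ; ⁻¹-cong = λ f≗g k → ≡.cong ℤ.-_ (f≗g k)
          }
        ; comm = λ f g k → ℤₚ.+-comm (f k) (g k)
        }
      ; *-cong = *ₚ-cong
      ; *-assoc = *ₚ-assoc
      ; *-identity = *ₚ-identityˡ , λ f k → ≡.trans (*ₚ-comm f 1ₚ k) (*ₚ-identityˡ f k)
      ; distrib = (λ h f g k → ≡.trans (*ₚ-comm h (f +ₚ g) k) (≡.trans (*ₚ-distribʳ h f g k)
                                 (≡.cong₂ ℤ._+_ (*ₚ-comm f h k) (*ₚ-comm g h k))))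
                , *ₚ-distribʳ
      }
    ; *-comm = *ₚ-comm
    }

  commutativeRing : CommutativeRing 0ℓ 0ℓ
  commutativeRing = record { isCommutativeRing = isCommutativeRing }

  qpow-0 : qpow 0 ≗ 1ₚ
  qpow-0 zero    = ≡.refl
  qpow-0 (suc k) = ≡.refl

  qpow-*ₚ-suc : ∀ m g k → (qpow (suc m) *ₚ g) (suc k) ≡ (qpow m *ₚ g) k
  qpow-*ₚ-suc m g k = ≡.trans (*ₚ-sucˡ (qpow (suc m)) g k) (ℤₚ.+-identityˡ _)

  qpow-+ : ∀ m n → qpow (m ℕ.+ n) ≗ qpow m *ₚ qpow n
  qpow-+ zero    n k       = ≡.sym (≡.trans (*ₚ-cong {g = qpow n} qpow-0 (λ _ → ≡.refl) k) (*ₚ-identityˡ (qpow n) k))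
  qpow-+ (suc m) n zero    = ≡.refl
  qpow-+ (suc m) n (suc k) = ≡.trans (qpow-+ m n k) (≡.sym (qpow-*ₚ-suc m (qpow n) k))

  qpow-*ₚ-≥ : ∀ m g i → (qpow m *ₚ g) (m ℕ.+ i) ≡ g i
  qpow-*ₚ-≥ zero    g i = ≡.trans (*ₚ-cong {g = g} qpow-0 (λ _ → ≡.refl) i) (*ₚ-identityˡ g i)
  qpow-*ₚ-≥ (suc m) g i = ≡.trans (qpow-*ₚ-suc m g (m ℕ.+ i)) (qpow-*ₚ-≥ m g i)

  qpow-*ₚ-< : ∀ m g {k} → k < m → (qpow m *ₚ g) k ≡ + 0
  qpow-*ₚ-< (suc m) g {zero}  _         = *ₚ-zero (qpow (suc m)) g
  qpow-*ₚ-< (suc m) g {suc k} (s≤s k<m) = ≡.trans (qpow-*ₚ-suc m g k) (qpow-*ₚ-< m g k<m)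

  -- From index m + 1 on, the product subtracts two equal coefficients, because divisibility by m +
  -- 1 survives a shift by m + 1. Below that index there is nothing to subtract, and 0 is the only
  -- multiple of m + 1.
  geomInv-inverse : ∀ m → (1ₚ -ₚ qpow (suc m)) *ₚ geomInv (suc m) ≗ 1ₚ
  geomInv-inverse m k = ≡.trans (expand k) (coefficient k)
    where
    g = geomInv (suc m)

    expand : (1ₚ -ₚ qpow (suc m)) *ₚ g ≗ g -ₚ (qpow (suc m) *ₚ g)
    expand = solve 2 (λ x y → (𝟙 :- x) :* y := y :- x :* y) (λ _ → ≡.refl) (qpow (suc m)) g
      where open IntegerCoefficientSolver commutativeRing

    coefficient : g -ₚ (qpow (suc m) *ₚ g) ≗ 1ₚ
    coefficient k with k ℕ.<? suc m
    coefficient zero    | yes k<m = ≡.cong₂ (λ b x → (if b then + 1 else + 0) ℤ.- x)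
      (dec-true (suc m ∣? 0) (suc m ∣0)) (qpow-*ₚ-< (suc m) g k<m)
    coefficient (suc k) | yes k<m = ≡.cong₂ (λ b x → (if b then + 1 else + 0) ℤ.- x)
      (dec-false (suc m ∣? suc k) (λ m∣k → ℕₚ.<⇒≱ k<m (∣⇒≤ m∣k))) (qpow-*ₚ-< (suc m) g k<m)
    coefficient k       | no k≮m with ℕₚ.m≤n⇒∃[o]m+o≡n (ℕₚ.≮⇒≥ k≮m)
    ... | i , ≡.refl = begin
      g (suc m ℕ.+ i) ℤ.- (qpow (suc m) *ₚ g) (suc m ℕ.+ i)
        ≡⟨ ≡.cong₂ (λ b x → (if b then + 1 else + 0) ℤ.- x)
             (does-⇔ (mk⇔ (λ d → ∣m+n∣m⇒∣n d ∣-refl) (∣m∣n⇒∣m+n ∣-refl)) (suc m ∣? (suc m ℕ.+ i)) (suc m ∣? i))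
             (qpow-*ₚ-≥ (suc m) g i) ⟩
      g i ℤ.- g i
        ≡⟨ ℤₚ.+-inverseʳ (g i) ⟩
      + 0  ∎

-- Transfer of the abstract identity to power series.

open PowerSeries
module Sums = FiniteSums commutativeRing
module Q = QSeries.Pochhammer commutativeRing qpow qpow-0 qpow-+ geomInv geomInv-inverse

sumPS-cong : ∀ {F G} n → (∀ i → F i ≗ G i) → sumPS F n ≗ Sums.sum G n
sumPS-cong zero    F≗G k = ≡.refl
sumPS-cong (suc n) F≗G k = ≡.cong₂ ℤ._+_ (sumPS-cong n F≗G k) (F≗G n k)

poch≗ : ∀ s L → poch s L ≗ Q.poch s L
poch≗ s zero    k = ≡.refl
poch≗ s (suc L) k = *ₚ-cong {g = 1ₚ -ₚ qpow (s ℕ.* suc L)} (poch≗ s L) (λ _ → ≡.refl) k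

pochInv≗ : ∀ s L → pochInv s L ≗ Q.ipoch s L
pochInv≗ s zero    k = ≡.refl
pochInv≗ s (suc L) k = *ₚ-cong {g = geomInv (s ℕ.* suc L)} (pochInv≗ s L) (λ _ → ≡.refl) k

qbin≗ : ∀ i j → qbin i j ≗ Q.qbin i j
qbin≗ (+ m)    (+ n)    = *ₚ-cong (*ₚ-cong (poch≗ 1 (m ℕ.+ n)) (pochInv≗ 1 m)) (pochInv≗ 1 n)
qbin≗ (+ m)    -[1+ n ] k = ≡.refl
qbin≗ -[1+ m ] j        k = ≡.refl

sgn≗ : ∀ n → Q.sgn n ≗ ((ℤ.- + 1) ℤ.^ n) ·ₚ 1ₚ
sgn≗ zero    k = ≡.sym (ℤₚ.*-identityˡ (1ₚ k))
sgn≗ (suc n) k = ≡.trans (≡.cong ℤ.-_ (sgn≗ n k)) (lemma ((ℤ.- + 1) ℤ.^ n) (1ₚ k))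
  where
  lemma : ∀ c x → ℤ.- (c ℤ.* x) ≡ (ℤ.- + 1) ℤ.* c ℤ.* x
  lemma = ℤRing.solve-∀

-- The sign is a scalar action on series, which an abstract ring lacks, so it becomes multiplication
-- by a constant series.
-1^-·ₚ : ∀ n f → ((ℤ.- + 1) ℤ.^ n) ·ₚ f ≗ Q.sgn n *ₚ f
-1^-·ₚ n f k = begin
  c ℤ.* f k                     ≡⟨ ≡.cong (c ℤ.*_) (*ₚ-identityˡ f k) ⟨
  c ℤ.* (1ₚ *ₚ f) k             ≡⟨ ·ₚ-*ₚ c 1ₚ f k ⟨
  ((c ·ₚ 1ₚ) *ₚ f) k            ≡⟨ *ₚ-cong {g = f} (sgn≗ n) (λ _ → ≡.refl) k ⟨
  (Q.sgn n *ₚ f) k              ∎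
  where
  open ≡-Reasoning
  c = (ℤ.- + 1) ℤ.^ n

if-cong : ∀ b {f f′ : PS} g → f ≗ f′ → (if b then f else g) ≗ (if b then f′ else g)
if-cong false g f≗f′ k = ≡.refl
if-cong true  g f≗f′ k = f≗f′ k

leftTerm≗ : ∀ n a j →
  (if (3 ℕ.* j ℕ.+ a) ≤ᵇ n
    then poch 3 (n ∸ j ∸ 1) *ₚ (1ₚ -ₚ qpow (2 ℕ.* n ℕ.+ a))
         *ₚ qpow (3 ℕ.* j ℕ.* j ℕ.+ 3 ℕ.* j)
         *ₚ pochInv 1 (n ∸ 3 ℕ.* j ∸ a) *ₚ pochInv 6 j
    else 0ₚ) ≗ Q.leftTerm n a j
leftTerm≗ n a j = if-cong ((3 ℕ.* j ℕ.+ a) ≤ᵇ n) 0ₚ (*ₚ-cong (*ₚ-cong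
  (*ₚ-cong {g = qpow (3 ℕ.* j ℕ.* j ℕ.+ 3 ℕ.* j)}
    (*ₚ-cong {g = 1ₚ -ₚ qpow (2 ℕ.* n ℕ.+ a)} (poch≗ 3 (n ∸ j ∸ 1)) (λ _ → ≡.refl)) (λ _ → ≡.refl))
  (pochInv≗ 1 (n ∸ 3 ℕ.* j ∸ a))) (pochInv≗ 6 j))

rightTerm≗ : ∀ n a j →
  ((ℤ.- + 1) ℤ.^ ∣ j ∣)
    ·ₚ (qpow ∣ + 6 ℤ.* j ℤ.* j ℤ.+ + 3 ℤ.* j ∣
        *ₚ qbin (+ n ℤ.+ + 3 ℤ.* j ℤ.+ + (2 ℕ.* a)) (+ n ℤ.- + 3 ℤ.* j ℤ.- + a))
  ≗ Q.rightTerm n a j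
rightTerm≗ n a j k = ≡.trans
  (≡.cong (((ℤ.- + 1) ℤ.^ ∣ j ∣) ℤ.*_) (*ₚ-cong {f = e} (λ _ → ≡.refl) (qbin≗ x y) k))
  (-1^-·ₚ ∣ j ∣ (e *ₚ Q.qbin x y) k)
  where
  e = qpow ∣ + 6 ℤ.* j ℤ.* j ℤ.+ + 3 ℤ.* j ∣
  x = + n ℤ.+ + 3 ℤ.* j ℤ.+ + (2 ℕ.* a)
  y = + n ℤ.- + 3 ℤ.* j ℤ.- + a

-- The two-sided sum is finite: its terms with |j| > n vanish, so every window with N ≥ n holds the
-- full sum.
theorem1p9 : (n a : ℕ) → 1 ≤ n → a ≤ 1 → (N : ℕ) → n ≤ N → (k : ℕ) →
    sumPS (λ j → if (3 ℕ.* j ℕ.+ a) ≤ᵇ n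
    then poch 3 (n ℕ.∸ j ℕ.∸ 1) *ₚ (1ₚ -ₚ qpow (2 ℕ.* n ℕ.+ a))
    *ₚ qpow (3 ℕ.* j ℕ.* j ℕ.+ 3 ℕ.* j)
    *ₚ pochInv 1 (n ℕ.∸ 3 ℕ.* j ℕ.∸ a) *ₚ pochInv 6 j
    else 0ₚ) (ℕ.suc n) k
    ≡ sumℤrange (λ j → ((ℤ.- + 1) ℤ.^ ∣ j ∣)
    ·ₚ (qpow ∣ + 6 ℤ.* j ℤ.* j ℤ.+ + 3 ℤ.* j ∣
    *ₚ qbin (+ n ℤ.+ + 3 ℤ.* j ℤ.+ + (2 ℕ.* a)) (+ n ℤ.- + 3 ℤ.* j ℤ.- + a))) N k
theorem1p9 n a 1≤n a≤1 N n≤N k = begin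
  _                                                  ≡⟨ sumPS-cong (suc n) (leftTerm≗ n a) k ⟩
  Sums.sum (Q.leftTerm n a) (suc n) k                ≡⟨ Q.finiteIdentity n a N 1≤n a≤1 n≤N k ⟩
  Sums.sumℤrange (Q.rightTerm n a) N k               ≡⟨ sumPS-cong (suc (N ℕ.+ N)) (λ i → rightTerm≗ n a (+ i ℤ.- + N)) k ⟨
  _                                                  ∎
  where open ≡-Reasoning
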